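{- For all integers $n>0$ the following hold: \begin{align*} M_{2}(0,4,4n) &> M_{2}(2,4,4n) > M_{2}(1,4,4n)\quad\text{for } n\ne 1,\\ M_{2}(2,4,4n+2) &> M_{2}(0,4,4n+2) > M_{2}(1,4,4n+2),\\ M_{2}(1,4,2n+1) &> M_{2}(0,4,2n+1) = M_{2}(2,4,2n+1),\\ M_{3}(0,4,2n) &> M_{3}(1,4,2n) = M_{3}(2,4,2n),\\ M_{3}(0,4,2n+1) &= M_{3}(1,4,2n+1) > M_{3}(2,4,2n+1),\\ M_{k}(0,4,n) &> M_{k}(1,4,n) > M_{k}(2,4,n)\quad\text{for every integer } k\ge 4. \end{align*}
   Context: A partition is a finite weakly decreasing (possibly empty) sequence of positive integers, called its parts; $\ell(\pi)$ denotes the number of parts of the partition $\pi$. For an integer $k\ge 2$, a $k$-colored partition of $n\ge 0$ is an ordered $k$-tuple $\overrightarrow{\pi}=(\pi^{(1)},\pi^{(2)},\dots,\pi^{(k)})$ of partitions (each possibly empty) such that the sum of all parts of all the $\pi^{(i)}$ equals $n$. Its $k$-crank is defined as $\ell(\pi^{(1)})-\ell(\pi^{(2)})$. For $m\in\mathbb{Z}$, $M_k(m,n)$ denotes the number of $k$-colored partitions of $n$ with $k$-crank equal to $m$; equivalently, $$\sum_{n\ge 0}\sum_{m\in\mathbb{Z}}M_k(m,n)z^mq^n=\frac{(q;q)_\infty^{2-k}}{(zq;q)_\infty(z^{ -1}q;q)_\infty},\qquad (a;q)_\infty:=\prod_{i\ge 0}(1-aq^i).$$ With three arguments, $M_k(r,m,n)$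 denotes the number of $k$-colored partitions of $n$ whose $k$-crank is congruent to $r$ modulo $m$. -}

module Defs where

open import Data.Integer.Base as ℤ using (ℤ; +_; _⊖_)
open import Data.Integer.Divisibility using () renaming (_∣_ to _∣ᶻ_)
open import Data.List.Base using (List; []; _∷_; length; filter; concatMap; cartesianProductWith; upTo)
open import Data.List.Membership.Propositional using (_∈_; find; lose)
open import Data.List.Membership.Propositional.Properties
  using (∈-concatMap⁺; ∈-concatMap⁻; ∈-filter⁺; ∈-filter⁻; ∈-cartesianProductWith⁺; ∈-cartesianProductWith⁻; ∈-upTo⁺; ∈-upTo⁻)
open import Data.List.Relation.Unary.All as All using (All; []; _∷_)
open import Data.List.Relation.Unary.AllPairs using ([]; _∷_)
open import Data.List.Relation.Unary.Any using (here; there)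
open import Data.List.Relation.Unary.Linked using (Linked; linked?)
open import Data.List.Relation.Unary.Unique.Propositional using (Unique)
import Data.List.Relation.Unary.Unique.Propositional.Properties as Unique
open import Data.Nat.Base using (ℕ; zero; suc; _+_; _∸_; _≥_; _<_; z≤n; s≤s; NonTrivial)
open import Data.Nat.Divisibility using (_∣?_)
open import Data.Nat.ListAction using (sum)
open import Data.Nat.Properties using (_≥?_; m+[n∸m]≡n; m+n∸m≡n; m≤m+n; ≤-pred)
open import Data.Product.Base using (_×_; _,_; proj₁; proj₂)
open import Data.Vec.Base as Vec using (Vec; []; _∷_)
open import Data.Vec.Properties using (∷-injective)
open import Data.Vec.Relation.Unary.All as VecAll using ([]; _∷_)
open import Function.Bundles using (_⇔_; mk⇔; module Equivalence)
open import Relation.Binary.PropositionalEquality using (_≡_; refl; sym; trans; cong; cong₂)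
open import Relation.Nullary.Decidable using (Dec)

IsPartition : List ℕ → Set
IsPartition π = All (0 <_) π × Linked _≥_ π

IsColoredPartition : (k n : ℕ) → Vec (List ℕ) k → Set
IsColoredPartition k n πs = VecAll.All IsPartition πs × Vec.sum (Vec.map sum πs) ≡ n

-- NonTrivial k says k ≥ 2.
crank : (k : ℕ) .{{_ : NonTrivial k}} → Vec (List ℕ) k → ℤ
crank (suc zero) {{()}}
crank (suc (suc _)) (π₁ ∷ π₂ ∷ _) = length π₁ ⊖ length π₂

_≡_[mod_] : ℤ → ℤ → ℕ → Set
i ≡ j [mod m ] = + m ∣ᶻ i ℤ.- j

_≡?_[mod_] : ∀ i j m → Dec (i ≡ j [mod m ])
i ≡? j [mod m ] = m ∣? ℤ.∣ i ℤ.- j ∣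

-- The lists of positive integers with sum n: those with sum (suc n) arise from
-- exactly one of those with sum n, by a new leading 1 or by increasing the head.
extend : List ℕ → List (List ℕ)
extend []       = (1 ∷ []) ∷ []
extend (x ∷ xs) = (1 ∷ x ∷ xs) ∷ (suc x ∷ xs) ∷ []

compositions : ℕ → List (List ℕ)
compositions zero    = [] ∷ []
compositions (suc n) = concatMap extend (compositions n)

partitions : ℕ → List (List ℕ)
partitions n = filter (linked? _≥?_) (compositions n)

coloredPartitions : (k n : ℕ) → List (Vec (List ℕ) k)
coloredPartitionsWithHead : (k n i : ℕ) → List (Vec (List ℕ) (suc k))

coloredPartitions zero    zero    = [] ∷ []
coloredPartitions zero    (suc _) = []
coloredPartitions (suc k) n       = concatMap (coloredPartitionsWithHead k n) (upTo (suc n))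

coloredPartitionsWithHead k n i = cartesianProductWith _∷_ (partitions i) (coloredPartitions k (n ∸ i))

-- The list counted here is shown below (∈-coloredPartitions and
-- coloredPartitions-unique) to contain every k-colored partition of n exactly once.
M : (k : ℕ) .{{_ : NonTrivial k}} → (r m n : ℕ) → ℕ
M k r m n = length (filter (λ πs → crank k πs ≡? + r [mod m ]) (coloredPartitions k n))

private
  concatMap-unique : ∀ {A B : Set} (f : A → List B) (g : B → A) {xs : List A} →
    All (λ x → Unique (f x)) xs → All (λ x → ∀ {y} → y ∈ f x → g y ≡ x) xs →
    Unique xs → Unique (concatMap f xs)
  concatMap-unique f g {[]}     []       []       []       = []
  concatMap-unique f g {x ∷ xs} (u ∷ us) (h ∷ hs) (d ∷ ds) =
    Unique.++⁺ u (concatMap-unique f g us hs ds) disjoint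
    where
    disjoint : ∀ {y} → y ∈ f x × y ∈ concatMap f xs → _
    disjoint (p , q) with find (∈-concatMap⁻ f q)
    ... | x′ , x′∈xs , y∈ = All.lookup d x′∈xs (trans (sym (h p)) (All.lookup hs x′∈xs y∈))

  IsComposition : ℕ → List ℕ → Set
  IsComposition n xs = All (0 <_) xs × sum xs ≡ n

  unextend : List ℕ → List ℕ
  unextend (suc (suc x) ∷ xs) = suc x ∷ xs
  unextend (_ ∷ xs)           = xs
  unextend []                 = []

  extend-sound : ∀ {n ys} xs → IsComposition n xs → ys ∈ extend xs → IsComposition (suc n) ys
  extend-sound []       (_ , e)      (here refl)         = s≤s z≤n ∷ [] , cong suc e
  extend-sound (_ ∷ _)  (p , e)      (here refl)         = s≤s z≤n ∷ p , cong suc e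
  extend-sound (_ ∷ _)  (_ ∷ ps , e) (there (here refl)) = s≤s z≤n ∷ ps , cong suc e

  unextend-extend : ∀ {ys} xs → All (0 <_) xs → ys ∈ extend xs → unextend ys ≡ xs
  unextend-extend []          _ (here refl)               = refl
  unextend-extend (suc _ ∷ _) _ (here refl)               = refl
  unextend-extend (suc _ ∷ _) _ (there (here refl))       = refl
  unextend-extend (zero ∷ _)  (() ∷ _) _

  extend-unique : ∀ xs → All (0 <_) xs → Unique (extend xs)
  extend-unique []          _ = [] ∷ []
  extend-unique (suc _ ∷ _) _ = ((λ ()) ∷ []) ∷ [] ∷ []
  extend-unique (zero ∷ _)  (() ∷ _)

  compositions-sound : ∀ n {xs} → xs ∈ compositions n → IsComposition n xs
  compositions-sound zero    (here refl) = [] , refl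
  compositions-sound (suc n) xs∈ with find (∈-concatMap⁻ extend xs∈)
  ... | ys , ys∈ , q = extend-sound ys (compositions-sound n ys∈) q

  compositions-complete : ∀ n {xs} → IsComposition n xs → xs ∈ compositions n
  compositions-complete zero    {[]}               _             = here refl
  compositions-complete zero    {zero ∷ _}         (() ∷ _ , _)
  compositions-complete (suc n) {zero ∷ _}         (() ∷ _ , _)
  compositions-complete (suc n) {suc zero ∷ []}    (_ ∷ p , refl) =
    ∈-concatMap⁺ extend (lose (compositions-complete n (p , refl)) (here refl))
  compositions-complete (suc n) {suc zero ∷ _ ∷ _} (_ ∷ p , refl) =
    ∈-concatMap⁺ extend (lose (compositions-complete n (p , refl)) (here refl))
  compositions-complete (suc n) {suc (suc _) ∷ _}  (_ ∷ p , refl) =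
    ∈-concatMap⁺ extend (lose (compositions-complete n (s≤s z≤n ∷ p , refl)) (there (here refl)))

  compositions-unique : ∀ n → Unique (compositions n)
  compositions-unique zero    = [] ∷ []
  compositions-unique (suc n) = concatMap-unique extend unextend
    (All.tabulate λ {xs} xs∈ → extend-unique xs (proj₁ (compositions-sound n xs∈)))
    (All.tabulate λ {xs} xs∈ → unextend-extend xs (proj₁ (compositions-sound n xs∈)))
    (compositions-unique n)

∈-partitions : ∀ n {π} → π ∈ partitions n ⇔ (IsPartition π × sum π ≡ n)
∈-partitions n {π} = mk⇔ to from
  where
  to : π ∈ partitions n → IsPartition π × sum π ≡ n
  to π∈ with ∈-filter⁻ (linked? _≥?_) {xs = compositions n} π∈
  ... | c , l with compositions-sound n c
  ...   | p , e = (p , l) , e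
  from : IsPartition π × sum π ≡ n → π ∈ partitions n
  from ((p , l) , e) = ∈-filter⁺ (linked? _≥?_) (compositions-complete n (p , e)) l

partitions-unique : ∀ n → Unique (partitions n)
partitions-unique n = Unique.filter⁺ (linked? _≥?_) (compositions-unique n)

private
  module P n {π} = Equivalence (∈-partitions n {π})

  colored-sound : ∀ k n {πs} → πs ∈ coloredPartitions k n → IsColoredPartition k n πs
  colored-sound zero    zero {[]} _ = [] , refl
  colored-sound (suc k) n πs∈ with find (∈-concatMap⁻ (coloredPartitionsWithHead k n) {xs = upTo (suc n)} πs∈)
  ... | i , i∈ , q with ∈-cartesianProductWith⁻ _∷_ (partitions i) (coloredPartitions k (n ∸ i)) q
  ...   | π , πs , π∈ , πs∈′ , refl with P.to i π∈ | colored-sound k (n ∸ i) πs∈′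
  ...     | p , e | ps , es = p ∷ ps , trans (cong₂ _+_ e es) (m+[n∸m]≡n (≤-pred (∈-upTo⁻ i∈)))

  colored-complete : ∀ k n {πs} → IsColoredPartition k n πs → πs ∈ coloredPartitions k n
  colored-complete zero    _ {[]}     (_ , refl)      = here refl
  colored-complete (suc k) _ {π ∷ πs} (p ∷ ps , refl) =
    ∈-concatMap⁺ (coloredPartitionsWithHead k _)
      (lose (∈-upTo⁺ (s≤s (m≤m+n (sum π) _)))
        (∈-cartesianProductWith⁺ _∷_ (P.from (sum π) (p , refl))
          (colored-complete k _ (ps , sym (m+n∸m≡n (sum π) _)))))

∈-coloredPartitions : ∀ k n {πs} → πs ∈ coloredPartitions k n ⇔ IsColoredPartition k n πs
∈-coloredPartitions k n = mk⇔ (colored-sound k n) (colored-complete k n)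

coloredPartitions-unique : ∀ k n → Unique (coloredPartitions k n)
coloredPartitions-unique zero    zero    = [] ∷ []
coloredPartitions-unique zero    (suc _) = []
coloredPartitions-unique (suc k) n       = concatMap-unique
  (coloredPartitionsWithHead k n) (λ πs → sum (Vec.head πs)) {upTo (suc n)}
  (All.tabulate λ {i} _ → Unique.cartesianProductWith⁺ _∷_ ∷-injective
    (partitions-unique i) (coloredPartitions-unique k (n ∸ i)))
  (All.tabulate λ {i} _ → head-sum i)
  (Unique.upTo⁺ (suc n))
  where
  head-sum : ∀ i {πs} → πs ∈ coloredPartitionsWithHead k n i → sum (Vec.head πs) ≡ i
  head-sum i q with ∈-cartesianProductWith⁻ _∷_ (partitions i) (coloredPartitions k (n ∸ i)) q
  ... | _ , _ , π∈ , _ , refl = proj₂ (P.to i π∈)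

{-# OPTIONS --safe #-}
module Submission where

-- With c, s, ε the values of Re iˡ, Im iˡ, (−1)ˡ at the number l of parts, and C, S, E, P the
-- generating functions of partitions weighted by c, s, ε, 1, splitting off the first two colors gives
--   Σ (M k 0 − M k 2) qⁿ           = (C² + S²) Pᵏ⁻²,
--   Σ (M k 0 + M k 2 − 2 M k 1) qⁿ = E² Pᵏ⁻²,
-- the second because residues 1 and 3 are equally frequent (S C = C S). By Euler's theorem on
-- distinct and odd parts, X = C² + S² = 1 / (−q²; q²) = (q²; q⁴) and E² = 1 / (−q; q)² = (q; q²)².
-- k = 2: up to signs, X and E² count partitions into distinct parts twice an odd number, and pairs
--   of partitions into distinct odd parts; the latter dominate since (1 + y)² ≥ 1 + y².
-- k = 3: G = X P = 1 / ((q; q²) (q⁴; q⁴)) has positive coefficients, and E² P is G at −q.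
-- k ≥ 4: the even and the odd part of G are multiplied by Pᵏ⁻³, whose coefficients are positive.
-- Infinite products are avoided by working modulo q ^ (1 + N), where N factors suffice.

open import Defs
open import Algebra.Bundles using (CommutativeRing)
open import Data.Bool.Base using (if_then_else_)
open import Data.Integer.Base as ℤ using (ℤ; +_; 0ℤ; 1ℤ; -1ℤ)
open import Data.Integer.Divisibility.Signed using (_∣_; ∣ᵤ⇒∣; ∣⇒∣ᵤ; ∣m∣n⇒∣m+n; ∣m+n∣n⇒∣m; ∣-refl)
import Data.Integer.Properties as ℤ
open import Data.Integer.Tactic.RingSolver using (solve-∀)
open import Data.List.Base using (List; []; _∷_; _++_; map; length; filter; concatMap; cartesianProductWith; applyUpTo; upTo)
open import Data.List.Membership.Propositional using (_∈_)
open import Data.List.Membership.Propositional.Properties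
  using (∈-filter⁺; ∈-filter⁻; ∈-++⁺ˡ; ∈-++⁺ʳ; ∈-++⁻; ∈-map⁺; ∈-map⁻)
open import Data.List.Membership.Propositional.Properties.WithK using (unique∧set⇒bag)
import Data.List.Properties as List
open import Data.List.Relation.Binary.BagAndSetEquality using (∼bag⇒↭)
open import Data.List.Relation.Binary.Permutation.Propositional as ↭ using (_↭_)
open import Data.List.Relation.Unary.All as All using (All; []; _∷_; all?)
open import Data.List.Relation.Unary.AllPairs using (_∷_)
open import Data.List.Relation.Unary.Linked as Linked using (Linked; [-]; _∷_)
open import Data.List.Relation.Unary.Linked.Properties using (Linked⇒AllPairs)
open import Data.List.Relation.Unary.Unique.Propositional using (Unique)
import Data.List.Relation.Unary.Unique.Propositional.Properties as Unique
open import Data.Nat.Base as ℕ using (ℕ; zero; suc; z≤n; s≤s)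
open import Data.Nat.ListAction using (sum)
import Data.Nat.Properties as ℕ
import Data.Nat.Tactic.RingSolver as ℕSolver
open import Data.Product.Base using (_×_; _,_; proj₁; proj₂)
open import Data.Sum.Base using (_⊎_; inj₁; inj₂; [_,_]′)
open import Data.Vec.Base using (Vec; _∷_)
open import Function.Base using (_∘_; case_of_)
open import Function.Bundles using (_⇔_; mk⇔; module Equivalence)
open import Level using (0ℓ)
open import Relation.Binary.PropositionalEquality
  using (_≡_; _≗_; _≢_; refl; sym; trans; cong; cong₂; subst; module ≡-Reasoning)
open import Relation.Nullary using (Dec; does; yes; no; contradiction)
open import Relation.Nullary.Decidable using (does-⇔)

-- Products in a commutative ring

odd : ℕ → ℕ
odd i = suc (i ℕ.+ i)

module Products {c ℓ} (R : CommutativeRing c ℓ) where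
  open CommutativeRing R hiding (zero)
    renaming (refl to ≈-refl; sym to ≈-sym; trans to ≈-trans; reflexive to ≈-reflexive)
  open import Algebra.Properties.CommutativeSemiring.Exp commutativeSemiring public
  open import Algebra.Properties.Ring ring using (-‿distribʳ-*)
  open import Algebra.Properties.CommutativeSemigroup *-commutativeSemigroup
    using (x∙yz≈y∙xz; interchange)
  open import Relation.Binary.Reasoning.Setoid setoid

  ∏ : (ℕ → Carrier) → ℕ → Carrier
  ∏ h zero    = 1#
  ∏ h (suc m) = h m * ∏ h m

  ∏-cong : ∀ {g h} → (∀ i → g i ≈ h i) → ∀ m → ∏ g m ≈ ∏ h m
  ∏-cong g≈h zero    = ≈-refl
  ∏-cong g≈h (suc m) = *-cong (g≈h m) (∏-cong g≈h m)

  ∏-distrib-* : ∀ g h m → ∏ (λ i → g i * h i) m ≈ ∏ g m * ∏ h m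
  ∏-distrib-* g h zero    = ≈-sym (*-identityˡ 1#)
  ∏-distrib-* g h (suc m) = ≈-trans (*-congˡ (∏-distrib-* g h m)) (interchange _ _ _ _)

  -- In the applications `f m` is built from generating functions of partitions with parts at most
  -- `m`. Each factor `h m` removes the part size `m + 1`, so the whole product reduces `f m` to
  -- `f 0`.
  ∏-telescope : ∀ {h f : ℕ → Carrier} → f 0 ≈ 1# → (∀ m → h m * f (suc m) ≈ f m) → ∀ m → ∏ h m * f m ≈ 1#
  ∏-telescope f₀≈1 step zero    = ≈-trans (*-identityˡ _) f₀≈1
  ∏-telescope {h} {f} f₀≈1 step (suc m) = begin
    h m * ∏ h m * f (suc m)   ≈⟨ *-congʳ (*-comm _ _) ⟩
    ∏ h m * h m * f (suc m)   ≈⟨ *-assoc _ _ _ ⟩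
    ∏ h m * (h m * f (suc m)) ≈⟨ *-congˡ (step m) ⟩
    ∏ h m * f m               ≈⟨ ∏-telescope {h} {f} f₀≈1 step m ⟩
    1#                        ∎

  1−x∙1+x : ∀ x → (1# - x) * (1# + x) ≈ 1# - x * x
  1−x∙1+x x = begin
    (1# - x) * (1# + x)             ≈⟨ distribˡ _ _ _ ⟩
    (1# - x) * 1# + (1# - x) * x    ≈⟨ +-cong (*-identityʳ _) (distribʳ _ _ _) ⟩
    1# - x + (1# * x + - x * x)     ≈⟨ +-congˡ (+-cong (*-identityˡ x) (≈-sym -x∙x)) ⟩
    1# - x + (x - x * x)            ≈⟨ +-assoc _ _ _ ⟩
    1# + (- x + (x - x * x))        ≈⟨ +-congˡ (≈-sym (+-assoc _ _ _)) ⟩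
    1# + (- x + x - x * x)          ≈⟨ +-congˡ (+-congʳ (-‿inverseˡ x)) ⟩
    1# + (0# - x * x)               ≈⟨ +-congˡ (+-identityˡ _) ⟩
    1# - x * x                      ∎
    where
    -x∙x : - (x * x) ≈ - x * x
    -x∙x = ≈-trans (-‿distribʳ-* x x) (*-comm _ _)

  x²^n≈x^n∙x^n : ∀ x n → (x * x) ^ n ≈ x ^ n * x ^ n
  x²^n≈x^n∙x^n x n = ^-distrib-* x x n

  x²^n≈x^[n+n] : ∀ x n → (x * x) ^ n ≈ x ^ (n ℕ.+ n)
  x²^n≈x^[n+n] x n = ≈-trans (x²^n≈x^n∙x^n x n) (≈-sym (^-homo-* x n n))

  -- Finite q-Pochhammer products: with `m` factors these are `(x; x)`, `(−x; x)`, `(x; x²)` and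
  -- `(−x; x²)`.
  D B O O⁺ : Carrier → ℕ → Carrier
  D  x = ∏ (λ i → 1# - x ^ suc i)
  B  x = ∏ (λ i → 1# + x ^ suc i)
  O  x = ∏ (λ i → 1# - x ^ odd i)
  O⁺ x = ∏ (λ i → 1# + x ^ odd i)

  -- Factorwise `(1 − y) (1 + y) = 1 − y²`. With `e = suc` it merges `D x` and `B x` into
  -- `D (x * x)`, with `e = odd` it merges `O x` and `O⁺ x` into `O (x * x)`.
  ∏-difference-of-squares : ∀ x (e : ℕ → ℕ) m →
    ∏ (λ i → 1# - x ^ e i) m * ∏ (λ i → 1# + x ^ e i) m ≈ ∏ (λ i → 1# - (x * x) ^ e i) m
  ∏-difference-of-squares x e m = begin
    ∏ (λ i → 1# - x ^ e i) m * ∏ (λ i → 1# + x ^ e i) m  ≈⟨ ∏-distrib-* _ _ m ⟨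
    ∏ (λ i → (1# - x ^ e i) * (1# + x ^ e i)) m          ≈⟨ ∏-cong (λ i → ≈-trans (1−x∙1+x (x ^ e i))
                                                              (+-congˡ (-‿cong (≈-sym (x²^n≈x^n∙x^n x (e i)))))) m ⟩
    ∏ (λ i → 1# - (x * x) ^ e i) m                       ∎

  -- Among the exponents 1, ..., 2m the odd ones form `O x m`, and the even ones, read as powers of
  -- `x²`, form `D (x * x) m`.
  D-split : ∀ x m → D x (m ℕ.+ m) ≈ O x m * D (x * x) m
  D-split x zero    = ≈-sym (*-identityˡ 1#)
  D-split x (suc m) rewrite ℕ.+-suc m m = begin
    (1# - x ^ suc (odd m)) * ((1# - x ^ odd m) * D x (m ℕ.+ m))
      ≈⟨ *-cong (+-congˡ (-‿cong (≈-sym x²^sm))) (*-congˡ (D-split x m)) ⟩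
    (1# - (x * x) ^ suc m) * ((1# - x ^ odd m) * (O x m * D (x * x) m))
      ≈⟨ *-congˡ (≈-sym (*-assoc _ _ _)) ⟩
    (1# - (x * x) ^ suc m) * (O x (suc m) * D (x * x) m)
      ≈⟨ x∙yz≈y∙xz _ _ _ ⟩
    O x (suc m) * D (x * x) (suc m)
      ∎
    where
    x²^sm : (x * x) ^ suc m ≈ x ^ suc (odd m)
    x²^sm = ≈-trans (x²^n≈x^[n+n] x (suc m)) (≈-reflexive (cong (λ k → x ^ suc k) (ℕ.+-suc m m)))

  module Nilpotent x N (x^[1+N]≈0 : x ^ suc N ≈ 0#) where

    -- Each factor beyond the first `N` is 1 minus a multiple of `x ^ suc N`, hence 1. So `N`
    -- factors act as the infinite product.
    D-stable : ∀ m → D x (m ℕ.+ N) ≈ D x N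
    D-stable zero    = ≈-refl
    D-stable (suc m) = begin
      (1# - x ^ suc (m ℕ.+ N)) * D x (m ℕ.+ N) ≈⟨ *-cong 1−x^≈1 (D-stable m) ⟩
      1# * D x N                               ≈⟨ *-identityˡ _ ⟩
      D x N                                    ∎
      where
      1−x^≈1 : 1# - x ^ suc (m ℕ.+ N) ≈ 1#
      1−x^≈1 = begin
        1# - x ^ suc (m ℕ.+ N)   ≡⟨ cong (λ k → 1# - x ^ k) (ℕ.+-suc m N) ⟨
        1# - x ^ (m ℕ.+ suc N)   ≈⟨ +-congˡ (-‿cong (^-homo-* x m (suc N))) ⟩
        1# - x ^ m * x ^ suc N   ≈⟨ +-congˡ (-‿cong (≈-trans (*-congˡ x^[1+N]≈0) (zeroʳ _))) ⟩
        1# - 0#                  ≈⟨ +-congˡ -0≈0 ⟩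
        1# + 0#                  ≈⟨ +-identityʳ 1# ⟩
        1#                       ∎
        where
        -0≈0 : - 0# ≈ 0#
        -0≈0 = ≈-trans (≈-sym (+-identityʳ _)) (-‿inverseˡ 0#)

    D≈O∙D : D x N ≈ O x N * D (x * x) N
    D≈O∙D = ≈-trans (≈-sym (D-stable N)) (D-split x N)

    x²-nilpotent : (x * x) ^ suc N ≈ 0#
    x²-nilpotent = ≈-trans (x²^n≈x^n∙x^n x (suc N)) (≈-trans (*-congʳ x^[1+N]≈0) (zeroˡ _))

    -- Multiplying `B x N` by `D x N` gives `D (x * x) N`, and `O x N` turns this back into `D x N`,
    -- which `u` then cancels.
    euler : ∀ {u} → D x N * u ≈ 1# → O x N * B x N ≈ 1#
    euler {u} Du≈1 = begin
      O x N * B x N                  ≈⟨ *-identityʳ _ ⟨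
      O x N * B x N * 1#             ≈⟨ *-congˡ Du≈1 ⟨
      O x N * B x N * (D x N * u)    ≈⟨ *-assoc _ _ _ ⟨
      O x N * B x N * D x N * u      ≈⟨ *-congʳ (*-assoc _ _ _) ⟩
      O x N * (B x N * D x N) * u    ≈⟨ *-congʳ (*-congˡ (≈-trans (*-comm _ _) (∏-difference-of-squares x suc N))) ⟩
      O x N * D (x * x) N * u        ≈⟨ *-congʳ D≈O∙D ⟨
      D x N * u                      ≈⟨ Du≈1 ⟩
      1#                             ∎

  inverse-unique : ∀ {u v w} → u * v ≈ 1# → v * w ≈ 1# → u ≈ w
  inverse-unique {u} {v} {w} uv≈1 vw≈1 = begin
    u             ≈⟨ *-identityʳ u ⟨
    u * 1#        ≈⟨ *-congˡ vw≈1 ⟨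
    u * (v * w)   ≈⟨ *-assoc u v w ⟨
    u * v * w     ≈⟨ *-congʳ uv≈1 ⟩
    1# * w        ≈⟨ *-identityˡ w ⟩
    w             ∎

  module CrankSeries {q N P E X} (q^[1+N]≈0 : q ^ suc N ≈ 0#)
    (DP≈1 : D q N * P ≈ 1#) (BE≈1 : B q N * E ≈ 1#) (BX≈1 : B (q * q) N * X ≈ 1#) where

    private
      module q¹ = Nilpotent q N q^[1+N]≈0
      module q² = Nilpotent (q * q) N q¹.x²-nilpotent

    D₄ : Carrier
    D₄ = D (q * q * (q * q)) N

    -- Here `P E = 1 / ((q; q) (−q; q))`. This supplies the inverse that `euler` requires at
    -- `q * q`.
    Dq²∙PE≈1 : D (q * q) N * (P * E) ≈ 1#
    Dq²∙PE≈1 = begin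
      D (q * q) N * (P * E)        ≈⟨ *-congʳ (∏-difference-of-squares q suc N) ⟨
      D q N * B q N * (P * E)      ≈⟨ interchange _ _ _ _ ⟩
      D q N * P * (B q N * E)      ≈⟨ *-cong DP≈1 BE≈1 ⟩
      1# * 1#                      ≈⟨ *-identityˡ 1# ⟩
      1#                           ∎

    E≈O : E ≈ O q N
    E≈O = ≈-sym (inverse-unique (q¹.euler DP≈1) BE≈1)

    X≈O : X ≈ O (q * q) N
    X≈O = ≈-sym (inverse-unique (q².euler Dq²∙PE≈1) BX≈1)

    -- Splitting off the odd exponents twice: `(q; q) = (q; q²) (q²; q⁴) (q⁴; q⁴)`.
    OO₂D₄P≈1 : O q N * (O (q * q) N * D₄) * P ≈ 1#
    OO₂D₄P≈1 = begin
      O q N * (O (q * q) N * D₄) * P ≈⟨ *-congʳ (*-congˡ q².D≈O∙D) ⟨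
      O q N * D (q * q) N * P        ≈⟨ *-congʳ q¹.D≈O∙D ⟨
      D q N * P                      ≈⟨ DP≈1 ⟩
      1#                             ∎

    -- The series `X = (q²; q⁴)` takes the place of the middle factor of this triple product.
    D₄O∙XP≈1 : D₄ * (O q N * (X * P)) ≈ 1#
    D₄O∙XP≈1 = begin
      D₄ * (O q N * (X * P))           ≈⟨ *-congˡ (*-assoc _ _ _) ⟨
      D₄ * (O q N * X * P)             ≈⟨ *-assoc _ _ _ ⟨
      D₄ * (O q N * X) * P             ≈⟨ *-congʳ (x∙yz≈y∙xz _ _ _) ⟩
      O q N * (D₄ * X) * P             ≈⟨ *-congʳ (*-congˡ (≈-trans (*-comm _ _) (*-congʳ X≈O))) ⟩
      O q N * (O (q * q) N * D₄) * P   ≈⟨ OO₂D₄P≈1 ⟩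
      1#                               ∎

    -- One factor of `E² = (q; q²)²` combines with `(−q; q²)` to `(q²; q⁴)`, which restores the
    -- triple product. Hence `E² P` is `X P` with `O⁺` in place of `O`.
    D₄O⁺∙E²P≈1 : D₄ * (O⁺ q N * (E * E * P)) ≈ 1#
    D₄O⁺∙E²P≈1 = begin
      D₄ * (O⁺ q N * (E * E * P))             ≈⟨ *-congˡ (*-congˡ (*-congʳ (*-cong E≈O E≈O))) ⟩
      D₄ * (O⁺ q N * (O q N * O q N * P))     ≈⟨ *-congˡ (*-assoc _ _ _) ⟨
      D₄ * (O⁺ q N * (O q N * O q N) * P)     ≈⟨ *-assoc _ _ _ ⟨
      D₄ * (O⁺ q N * (O q N * O q N)) * P     ≈⟨ *-congʳ (*-congˡ (*-assoc _ _ _)) ⟨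
      D₄ * (O⁺ q N * O q N * O q N) * P       ≈⟨ *-congʳ (*-congˡ (*-congʳ (≈-trans (*-comm _ _) (∏-difference-of-squares q odd N)))) ⟩
      D₄ * (O (q * q) N * O q N) * P          ≈⟨ *-congʳ (*-comm _ _) ⟩
      O (q * q) N * O q N * D₄ * P            ≈⟨ *-congʳ (*-congʳ (*-comm _ _)) ⟩
      O q N * O (q * q) N * D₄ * P            ≈⟨ *-congʳ (*-assoc _ _ _) ⟩
      O q N * (O (q * q) N * D₄) * P          ≈⟨ OO₂D₄P≈1 ⟩
      1#                                      ∎

  open import Algebra.Solver.Ring.NaturalCoefficients.Default commutativeSemiring
    using (solve; con; _:=_; _:+_; _:*_)

  -- The hypotheses say `c₀ + i s₀ = (1 − i x) (c + i s)`, and the norm of `1 − i x` is `1 + x²`.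
  -- They are stated without subtraction so that a semiring solver suffices.
  sum-of-squares-step : ∀ x {c s c₀ s₀} → c₀ ≈ c + x * s → s ≈ s₀ + x * c →
    (1# + x * x) * (c * c + s * s) ≈ c₀ * c₀ + s₀ * s₀
  sum-of-squares-step x {c} {s} {c₀} {s₀} c₀≈ s≈ = begin
    (1# + x * x) * (c * c + s * s)
      ≈⟨ *-congˡ (+-congˡ (*-cong s≈ s≈)) ⟩
    (1# + x * x) * (c * c + (s₀ + x * c) * (s₀ + x * c))
      ≈⟨ solve 3 (λ x c s₀ →
           (con 1 :+ x :* x) :* (c :* c :+ (s₀ :+ x :* c) :* (s₀ :+ x :* c)) :=
           (c :+ x :* (s₀ :+ x :* c)) :* (c :+ x :* (s₀ :+ x :* c)) :+ s₀ :* s₀)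
           ≈-refl x c s₀ ⟩
    (c + x * (s₀ + x * c)) * (c + x * (s₀ + x * c)) + s₀ * s₀
      ≈⟨ +-congʳ (*-cong c₀≈′ c₀≈′) ⟨
    c₀ * c₀ + s₀ * s₀
      ∎
    where
    c₀≈′ : c₀ ≈ c + x * (s₀ + x * c)
    c₀≈′ = ≈-trans c₀≈ (+-congˡ (*-congˡ s≈))

-- Power series

Series : Set
Series = ℕ → ℤ

infixl 6 _⊕_
infixl 7 _⊛_ _⊙_

-- `⊛` is the Cauchy product, by recursion along `f = f 0 + q · (f ∘ suc)`. `⊙` multiplies
-- coefficientwise, so that `ε ⊙ f` is `f` at `−q`.
_⊕_ _⊙_ _⊛_ : Series → Series → Series
(f ⊕ g) n = f n ℤ.+ g n
(f ⊙ g) n = f n ℤ.* g n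
(f ⊛ g) zero    = f zero ℤ.* g zero
(f ⊛ g) (suc n) = f zero ℤ.* g (suc n) ℤ.+ (f ∘ suc ⊛ g) n

⊖ : Series → Series
(⊖ f) n = ℤ.- f n

0̂ 1̂ q : Series
0̂ _ = 0ℤ
1̂ zero    = 1ℤ
1̂ (suc _) = 0ℤ
q zero    = 0ℤ
q (suc n) = 1̂ n

infix 4 _≈[_]_

_≈[_]_ : Series → ℕ → Series → Set
f ≈[ N ] g = ∀ n → n ℕ.≤ N → f n ≡ g n

-- A coefficient of a product at `n` involves only coefficients at indices up to `n`. This makes
-- truncation compatible with multiplication.
⊛-cong : ∀ N {f f′ g g′} → f ≈[ N ] f′ → g ≈[ N ] g′ → f ⊛ g ≈[ N ] f′ ⊛ g′
⊛-cong N f≈ g≈ zero    _     = cong₂ ℤ._*_ (f≈ 0 z≤n) (g≈ 0 z≤n)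
⊛-cong (suc N) f≈ g≈ (suc n) (s≤s n≤N) = cong₂ ℤ._+_
  (cong₂ ℤ._*_ (f≈ 0 z≤n) (g≈ (suc n) (s≤s n≤N)))
  (⊛-cong N (λ i i≤N → f≈ (suc i) (s≤s i≤N)) (λ i i≤N → g≈ i (ℕ.m≤n⇒m≤1+n i≤N)) n n≤N)

⊛-cong-≗ : ∀ {f f′ g g′} → f ≗ f′ → g ≗ g′ → f ⊛ g ≗ f′ ⊛ g′
⊛-cong-≗ f≈ g≈ n = ⊛-cong n (λ i _ → f≈ i) (λ i _ → g≈ i) n ℕ.≤-refl

⊛-zeroˡ : ∀ g → 0̂ ⊛ g ≗ 0̂
⊛-zeroˡ g zero    = ℤ.*-zeroˡ (g 0)
⊛-zeroˡ g (suc n) = cong₂ ℤ._+_ (ℤ.*-zeroˡ (g (suc n))) (⊛-zeroˡ g n)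

⊛-identityˡ : ∀ g → 1̂ ⊛ g ≗ g
⊛-identityˡ g zero    = ℤ.*-identityˡ (g 0)
⊛-identityˡ g (suc n) = trans (cong₂ ℤ._+_ (ℤ.*-identityˡ (g (suc n))) (⊛-zeroˡ g n)) (ℤ.+-identityʳ _)

⊛-distribʳ : ∀ h f g → (f ⊕ g) ⊛ h ≗ f ⊛ h ⊕ g ⊛ h
⊛-distribʳ h f g zero    = ℤ.*-distribʳ-+ (h 0) (f 0) (g 0)
⊛-distribʳ h f g (suc n) = trans
  (cong (λ t → (f 0 ℤ.+ g 0) ℤ.* h (suc n) ℤ.+ t) (⊛-distribʳ h (f ∘ suc) (g ∘ suc) n))
  (interchange (f 0) (g 0) (h (suc n)) _ _)
  where
  interchange : ∀ a b c x y → (a ℤ.+ b) ℤ.* c ℤ.+ (x ℤ.+ y) ≡ (a ℤ.* c ℤ.+ x) ℤ.+ (b ℤ.* c ℤ.+ y)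
  interchange = solve-∀

⊛-scaleˡ : ∀ a f g → (λ n → a ℤ.* f n) ⊛ g ≗ (λ n → a ℤ.* (f ⊛ g) n)
⊛-scaleˡ a f g zero    = ℤ.*-assoc a (f 0) (g 0)
⊛-scaleˡ a f g (suc n) = trans
  (cong (λ t → a ℤ.* f 0 ℤ.* g (suc n) ℤ.+ t) (⊛-scaleˡ a (f ∘ suc) g n))
  (factor a (f 0) (g (suc n)) _)
  where
  factor : ∀ a b c x → a ℤ.* b ℤ.* c ℤ.+ a ℤ.* x ≡ a ℤ.* (b ℤ.* c ℤ.+ x)
  factor = solve-∀

⊛-assoc : ∀ f g h → (f ⊛ g) ⊛ h ≗ f ⊛ (g ⊛ h)
⊛-assoc f g h zero    = ℤ.*-assoc (f 0) (g 0) (h 0)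
⊛-assoc f g h (suc n) = trans
  (cong (λ t → f 0 ℤ.* g 0 ℤ.* h (suc n) ℤ.+ t) (trans
    (⊛-distribʳ h (λ i → f 0 ℤ.* g (suc i)) (f ∘ suc ⊛ g) n)
    (cong₂ ℤ._+_ (⊛-scaleˡ (f 0) (g ∘ suc) h n) (⊛-assoc (f ∘ suc) g h n))))
  (regroup (f 0) (g 0) (h (suc n)) _ _)
  where
  regroup : ∀ a b c x y → a ℤ.* b ℤ.* c ℤ.+ (a ℤ.* x ℤ.+ y) ≡ a ℤ.* (b ℤ.* c ℤ.+ x) ℤ.+ y
  regroup = solve-∀

-- Mirror image of the defining recursion, peeling the right factor instead of the left; `⊛-comm`
-- plays one against the other.
⊛-sucʳ : ∀ f g n → (f ⊛ g) (suc n) ≡ (f ⊛ (g ∘ suc)) n ℤ.+ f (suc n) ℤ.* g 0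
⊛-sucʳ f g zero    = refl
⊛-sucʳ f g (suc n) = trans
  (cong (λ t → f 0 ℤ.* g (suc (suc n)) ℤ.+ t) (⊛-sucʳ (f ∘ suc) g n))
  (sym (ℤ.+-assoc (f 0 ℤ.* g (suc (suc n))) _ _))

⊛-comm : ∀ f g → f ⊛ g ≗ g ⊛ f
⊛-comm f g zero    = ℤ.*-comm (f 0) (g 0)
⊛-comm f g (suc n) = trans
  (cong₂ ℤ._+_ (ℤ.*-comm (f 0) (g (suc n))) (⊛-comm (f ∘ suc) g n))
  (trans (ℤ.+-comm (g (suc n) ℤ.* f 0) _) (sym (⊛-sucʳ g f n)))

-- Coefficients beyond N are ignored, so that q ^ (1 + N) vanishes in this ring.
truncatedRing : ℕ → CommutativeRing 0ℓ 0ℓ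
truncatedRing N = record
  { Carrier = Series ; _≈_ = _≈[ N ]_ ; _+_ = _⊕_ ; _*_ = _⊛_ ; -_ = ⊖ ; 0# = 0̂ ; 1# = 1̂
  ; isCommutativeRing = record
    { isRing = record
      { +-isAbelianGroup = record
        { isGroup = record
          { isMonoid = record
            { isSemigroup = record
              { isMagma = record
                { isEquivalence = record
                  { refl = λ _ _ → refl
                  ; sym = λ f≈g n n≤N → sym (f≈g n n≤N)
                  ; trans = λ f≈g g≈h n n≤N → trans (f≈g n n≤N) (g≈h n n≤N)
                  }
                ; ∙-cong = λ f≈ g≈ n n≤N → cong₂ ℤ._+_ (f≈ n n≤N) (g≈ n n≤N)
                }
              ; assoc = λ f g h n _ → ℤ.+-assoc (f n) (g n) (h n)
              }
            ; identity = (λ f n _ → ℤ.+-identityˡ (f n)) , (λ f n _ → ℤ.+-identityʳ (f n))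
            }
          ; inverse = (λ f n _ → ℤ.+-inverseˡ (f n)) , (λ f n _ → ℤ.+-inverseʳ (f n))
          ; ⁻¹-cong = λ f≈ n n≤N → cong ℤ.-_ (f≈ n n≤N)
          }
        ; comm = λ f g n _ → ℤ.+-comm (f n) (g n)
        }
      ; *-cong = ⊛-cong N
      ; *-assoc = λ f g h n _ → ⊛-assoc f g h n
      ; *-identity = (λ f n _ → ⊛-identityˡ f n)
                   , (λ f n _ → trans (⊛-comm f 1̂ n) (⊛-identityˡ f n))
      ; distrib = (λ f g h n _ → trans (⊛-comm f (g ⊕ h) n) (trans (⊛-distribʳ f g h n)
                    (cong₂ ℤ._+_ (⊛-comm g f n) (⊛-comm h f n))))
                , (λ f g h n _ → ⊛-distribʳ f g h n)
      }
    ; *-comm = λ f g n _ → ⊛-comm f g n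
    }
  }

-- Generating functions of lists of partitions

-- Multiplication by `q ^ a`, as `q^⊛` shows, in a form whose coefficients can be compared by
-- recursion.
shift : ℕ → Series → Series
shift zero    f n       = f n
shift (suc a) f zero    = 0ℤ
shift (suc a) f (suc n) = shift a f n

shift-+ : ∀ a f n → shift a f (a ℕ.+ n) ≡ f n
shift-+ zero    f n = refl
shift-+ (suc a) f n = shift-+ a f n

shift-< : ∀ {a n} f → n ℕ.< a → shift a f n ≡ 0ℤ
shift-< {suc a} {zero}  f _         = refl
shift-< {suc a} {suc n} f (s≤s n<a) = shift-< f n<a

∑ : ∀ {A : Set} → (A → ℤ) → List A → ℤ
∑ f []       = 0ℤ
∑ f (x ∷ xs) = f x ℤ.+ ∑ f xs

module _ {A : Set} where

  ∑-cong : ∀ {f g : A → ℤ} → f ≗ g → ∑ f ≗ ∑ g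
  ∑-cong f≗g []       = refl
  ∑-cong f≗g (x ∷ xs) = cong₂ ℤ._+_ (f≗g x) (∑-cong f≗g xs)

  ∑-++ : ∀ (f : A → ℤ) xs ys → ∑ f (xs ++ ys) ≡ ∑ f xs ℤ.+ ∑ f ys
  ∑-++ f []       ys = sym (ℤ.+-identityˡ _)
  ∑-++ f (x ∷ xs) ys = trans (cong (ℤ._+_ (f x)) (∑-++ f xs ys)) (sym (ℤ.+-assoc (f x) _ _))

  ∑-↭ : ∀ (f : A → ℤ) {xs ys} → xs ↭ ys → ∑ f xs ≡ ∑ f ys
  ∑-↭ f ↭.refl          = refl
  ∑-↭ f (↭.prep x p)    = cong (ℤ._+_ (f x)) (∑-↭ f p)
  ∑-↭ f (↭.swap x y p)  = trans (cong (λ t → f x ℤ.+ (f y ℤ.+ t)) (∑-↭ f p)) (exchange (f x) (f y) _)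
    where
    exchange : ∀ a b c → a ℤ.+ (b ℤ.+ c) ≡ b ℤ.+ (a ℤ.+ c)
    exchange = solve-∀
  ∑-↭ f (↭.trans p p′)  = trans (∑-↭ f p) (∑-↭ f p′)

  ∑-map : ∀ {B : Set} (f : A → ℤ) (g : B → A) xs → ∑ f (map g xs) ≡ ∑ (f ∘ g) xs
  ∑-map f g []       = refl
  ∑-map f g (x ∷ xs) = cong (ℤ._+_ (f (g x))) (∑-map f g xs)

  ∑-+ : ∀ (f g : A → ℤ) xs → ∑ (λ x → f x ℤ.+ g x) xs ≡ ∑ f xs ℤ.+ ∑ g xs
  ∑-+ f g []       = refl
  ∑-+ f g (x ∷ xs) = trans (cong (ℤ._+_ (f x ℤ.+ g x)) (∑-+ f g xs)) (exchange (f x) (g x) _ _)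
    where
    exchange : ∀ a b c d → a ℤ.+ b ℤ.+ (c ℤ.+ d) ≡ a ℤ.+ c ℤ.+ (b ℤ.+ d)
    exchange = solve-∀

  ∑-*ˡ : ∀ a (f : A → ℤ) xs → ∑ (λ x → a ℤ.* f x) xs ≡ a ℤ.* ∑ f xs
  ∑-*ˡ a f []       = sym (ℤ.*-zeroʳ a)
  ∑-*ˡ a f (x ∷ xs) = trans (cong (ℤ._+_ (a ℤ.* f x)) (∑-*ˡ a f xs)) (sym (ℤ.*-distribˡ-+ a (f x) _))

∑-cartesianProductWith : ∀ {A B C : Set} (_•_ : A → B → C) {F : C → ℤ} {f : A → ℤ} {g : B → ℤ} →
  (∀ x y → F (x • y) ≡ f x ℤ.* g y) → ∀ xs ys →
  ∑ F (cartesianProductWith _•_ xs ys) ≡ ∑ f xs ℤ.* ∑ g ys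
∑-cartesianProductWith _•_ F≡fg [] ys = refl
∑-cartesianProductWith _•_ {F} {f} {g} F≡fg (x ∷ xs) ys = begin
  ∑ F (map (x •_) ys ++ cartesianProductWith _•_ xs ys)
    ≡⟨ ∑-++ F (map (x •_) ys) _ ⟩
  ∑ F (map (x •_) ys) ℤ.+ ∑ F (cartesianProductWith _•_ xs ys)
    ≡⟨ cong₂ ℤ._+_ (trans (∑-map F (x •_) ys) (trans (∑-cong (F≡fg x) ys) (∑-*ˡ (f x) g ys)))
                   (∑-cartesianProductWith _•_ F≡fg xs ys) ⟩
  f x ℤ.* ∑ g ys ℤ.+ ∑ f xs ℤ.* ∑ g ys
    ≡⟨ ℤ.*-distribʳ-+ (∑ g ys) (f x) (∑ f xs) ⟨
  (f x ℤ.+ ∑ f xs) ℤ.* ∑ g ys ∎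
  where open ≡-Reasoning

∑-convolution : ∀ {A : Set} (F : A → ℤ) (L : ℕ → ℕ → List A) (f g : Series) →
  (∀ i j → ∑ F (L i j) ≡ f i ℤ.* g j) → ∀ n →
  ∑ F (concatMap (λ i → L i (n ℕ.∸ i)) (upTo (suc n))) ≡ (f ⊛ g) n
∑-convolution F L f g F≡fg n = go L f F≡fg (λ i → i) n _ λ _ → refl
  where
  open ≡-Reasoning
  -- Generalised for the recursion from `f` to `f ∘ suc`: `h` enumerates the indices that remain,
  -- while the summand `K` of the original `concatMap` stays fixed.
  go : ∀ L f → (∀ i j → ∑ F (L i j) ≡ f i ℤ.* g j) → ∀ (h : ℕ → ℕ) n K →
    (∀ i → K (h i) ≡ L i (n ℕ.∸ i)) →
    ∑ F (concatMap K (applyUpTo h (suc n))) ≡ (f ⊛ g) n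
  go L f e h zero K K≡ = begin
    ∑ F (K (h 0) ++ [])        ≡⟨ cong (∑ F) (List.++-identityʳ (K (h 0))) ⟩
    ∑ F (K (h 0))              ≡⟨ cong (∑ F) (K≡ 0) ⟩
    ∑ F (L 0 0)                ≡⟨ e 0 0 ⟩
    f 0 ℤ.* g 0                ∎
  go L f e h (suc n) K K≡ = begin
    ∑ F (K (h 0) ++ concatMap K (applyUpTo (h ∘ suc) (suc n)))
      ≡⟨ ∑-++ F (K (h 0)) _ ⟩
    ∑ F (K (h 0)) ℤ.+ ∑ F (concatMap K (applyUpTo (h ∘ suc) (suc n)))
      ≡⟨ cong₂ ℤ._+_ (trans (cong (∑ F) (K≡ 0)) (e 0 (suc n)))
           (go (L ∘ suc) (f ∘ suc) (e ∘ suc) (h ∘ suc) n K (K≡ ∘ suc)) ⟩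
    f 0 ℤ.* g (suc n) ℤ.+ (f ∘ suc ⊛ g) n
      ∎

-- Partitions with bounded parts

partitionsUpTo : (m n : ℕ) → List (List ℕ)
partitionsUpTo m n = filter (all? (ℕ._≤? m)) (partitions n)

∈-partitionsUpTo : ∀ m n {π} → π ∈ partitionsUpTo m n ⇔ (IsPartition π × sum π ≡ n × All (ℕ._≤ m) π)
∈-partitionsUpTo m n {π} = mk⇔ to from
  where
  module E = Equivalence (∈-partitions n {π})
  to : π ∈ partitionsUpTo m n → IsPartition π × sum π ≡ n × All (ℕ._≤ m) π
  to π∈ = case ∈-filter⁻ (all? (ℕ._≤? m)) {xs = partitions n} π∈ of λ
    (π∈′ , ≤m) → proj₁ (E.to π∈′) , proj₂ (E.to π∈′) , ≤m
  from : IsPartition π × sum π ≡ n × All (ℕ._≤ m) π → π ∈ partitionsUpTo m n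
  from (p , e , ≤m) = ∈-filter⁺ (all? (ℕ._≤? m)) (E.from (p , e)) ≤m

partitionsUpTo-unique : ∀ m n → Unique (partitionsUpTo m n)
partitionsUpTo-unique m n = Unique.filter⁺ (all? (ℕ._≤? m)) (partitions-unique n)

parts≤sum : ∀ π → All (ℕ._≤ sum π) π
parts≤sum []      = []
parts≤sum (x ∷ π) = ℕ.m≤m+n x (sum π) ∷ All.map (λ y≤ → ℕ.≤-trans y≤ (ℕ.m≤n+m (sum π) x)) (parts≤sum π)

partitionsUpTo≡partitions : ∀ {m n} → n ℕ.≤ m → partitionsUpTo m n ≡ partitions n
partitionsUpTo≡partitions {m} {n} n≤m = List.filter-all (all? (ℕ._≤? m)) (All.tabulate λ {π} π∈ →
  All.map (λ x≤ → ℕ.≤-trans x≤ (ℕ.≤-trans (ℕ.≤-reflexive (proj₂ (Equivalence.to (∈-partitions n) π∈))) n≤m))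
    (parts≤sum π))

partitionsUpTo-zero : ∀ n → partitionsUpTo 0 (suc n) ≡ []
partitionsUpTo-zero n = List.filter-none (all? (ℕ._≤? 0)) (All.tabulate λ π∈ ≤0 →
  no-parts (proj₁ (proj₁ (Equivalence.to (∈-partitions (suc n)) π∈))) ≤0
           (proj₂ (Equivalence.to (∈-partitions (suc n)) π∈)))
  where
  no-parts : ∀ {π} → All (0 ℕ.<_) π → All (ℕ._≤ 0) π → sum π ≢ suc n
  no-parts []          []          ()
  no-parts (s≤s _ ∷ _) (() ∷ _) _

-- The largest part either is at most `m`, or equals `m + 1` and can be removed. Both lists are free
-- of repetitions and have the same members, hence they are permutations of each other.
partitionsUpTo-suc : ∀ m n → partitionsUpTo (suc m) (suc m ℕ.+ n) ↭
  partitionsUpTo m (suc m ℕ.+ n) ++ map (suc m ∷_) (partitionsUpTo (suc m) n)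
partitionsUpTo-suc m n = ∼bag⇒↭ (unique∧set⇒bag (partitionsUpTo-unique (suc m) (suc m ℕ.+ n))
  (Unique.++⁺ (partitionsUpTo-unique m (suc m ℕ.+ n))
    (Unique.map⁺ List.∷-injectiveʳ (partitionsUpTo-unique (suc m) n)) disjoint)
  (mk⇔ to from))
  where
  module L {π} = Equivalence (∈-partitionsUpTo (suc m) (suc m ℕ.+ n) {π})
  module K {π} = Equivalence (∈-partitionsUpTo m (suc m ℕ.+ n) {π})
  module J {π} = Equivalence (∈-partitionsUpTo (suc m) n {π})

  disjoint : ∀ {π} → π ∈ partitionsUpTo m (suc m ℕ.+ n) × π ∈ map (suc m ∷_) (partitionsUpTo (suc m) n) → _
  disjoint (π∈ , π∈′) with ∈-map⁻ (suc m ∷_) π∈′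
  ... | _ , _ , refl with K.to π∈
  ...   | _ , _ , 1+m≤m ∷ _ = ℕ.1+n≰n 1+m≤m

  to : ∀ {π} → π ∈ partitionsUpTo (suc m) (suc m ℕ.+ n) →
    π ∈ partitionsUpTo m (suc m ℕ.+ n) ++ map (suc m ∷_) (partitionsUpTo (suc m) n)
  to {π} π∈ with π | L.to π∈
  ... | x ∷ xs | (0<x ∷ 0<xs , l) , e , x≤ ∷ xs≤ with x ℕ.≟ suc m
  ...   | yes refl = ∈-++⁺ʳ _ (∈-map⁺ (suc m ∷_)
            (J.from ((0<xs , Linked.tail l) , ℕ.+-cancelˡ-≡ (suc m) _ _ e , xs≤)))
  ...   | no x≢   = ∈-++⁺ˡ (K.from ((0<x ∷ 0<xs , l) , e , x≤m ∷ All.map (λ y≤x → ℕ.≤-trans y≤x x≤m) y≤xs))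
    where
    x≤m : x ℕ.≤ m
    x≤m = ℕ.≤-pred (ℕ.≤∧≢⇒< x≤ x≢)
    y≤xs : All (ℕ._≤ x) xs
    y≤xs with Linked⇒AllPairs (λ i≥j j≥k → ℕ.≤-trans j≥k i≥j) l
    ... | h ∷ _ = h

  cons-linked : ∀ {π} → All (ℕ._≤ suc m) π → Linked ℕ._≥_ π → Linked ℕ._≥_ (suc m ∷ π)
  cons-linked []      _ = [-]
  cons-linked (h ∷ _) l = h ∷ l

  from : ∀ {π} → π ∈ partitionsUpTo m (suc m ℕ.+ n) ++ map (suc m ∷_) (partitionsUpTo (suc m) n) →
    π ∈ partitionsUpTo (suc m) (suc m ℕ.+ n)
  from π∈ with ∈-++⁻ (partitionsUpTo m (suc m ℕ.+ n)) π∈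
  ... | inj₁ π∈ˡ with K.to π∈ˡ
  ...   | p , e , ≤m = L.from (p , e , All.map ℕ.m≤n⇒m≤1+n ≤m)
  from π∈ | inj₂ π∈ʳ with ∈-map⁻ (suc m ∷_) π∈ʳ
  ... | _ , π∈″ , refl with J.to π∈″
  ...   | (0<π , l) , e , ≤m = L.from ((s≤s z≤n ∷ 0<π , cons-linked ≤m l) ,
            cong (suc m ℕ.+_) e , ℕ.≤-refl ∷ ≤m)

lengthSeries : (ℕ → ℤ) → Series
lengthSeries w n = ∑ (w ∘ length) (partitions n)

lengthSeriesUpTo : ℕ → (ℕ → ℤ) → Series
lengthSeriesUpTo m w n = ∑ (w ∘ length) (partitionsUpTo m n)

lengthSeriesUpTo≡lengthSeries : ∀ N w → lengthSeriesUpTo N w ≈[ N ] lengthSeries w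
lengthSeriesUpTo≡lengthSeries N w n n≤N = cong (∑ (w ∘ length)) (partitionsUpTo≡partitions n≤N)

lengthSeriesUpTo-zero : ∀ w n → lengthSeriesUpTo 0 w n ≡ w 0 ℤ.* 1̂ n
lengthSeriesUpTo-zero w zero    = trans (ℤ.+-identityʳ (w 0)) (sym (ℤ.*-identityʳ (w 0)))
lengthSeriesUpTo-zero w (suc n) =
  trans (cong (∑ (w ∘ length)) (partitionsUpTo-zero n)) (sym (ℤ.*-zeroʳ (w 0)))

-- Removing a part `m + 1` lowers the length by one, hence the weight `w ∘ suc`. For `n ≤ m` that
-- part does not fit and the shifted term vanishes.
lengthSeriesUpTo-suc : ∀ m w →
  lengthSeriesUpTo (suc m) w ≗ lengthSeriesUpTo m w ⊕ shift (suc m) (lengthSeriesUpTo (suc m) (w ∘ suc))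
lengthSeriesUpTo-suc m w n with n ℕ.≤? m
... | yes n≤m = begin
  lengthSeriesUpTo (suc m) w n
    ≡⟨ cong (∑ (w ∘ length)) (trans (partitionsUpTo≡partitions (ℕ.m≤n⇒m≤1+n n≤m)) (sym (partitionsUpTo≡partitions n≤m))) ⟩
  lengthSeriesUpTo m w n
    ≡⟨ ℤ.+-identityʳ _ ⟨
  lengthSeriesUpTo m w n ℤ.+ 0ℤ
    ≡⟨ cong (ℤ._+_ (lengthSeriesUpTo m w n)) (shift-< _ (s≤s n≤m)) ⟨
  (lengthSeriesUpTo m w ⊕ shift (suc m) (lengthSeriesUpTo (suc m) (w ∘ suc))) n
    ∎
  where open ≡-Reasoning
... | no n≰m = subst (λ n → lengthSeriesUpTo (suc m) w n ≡
      (lengthSeriesUpTo m w ⊕ shift (suc m) (lengthSeriesUpTo (suc m) (w ∘ suc))) n)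
      (ℕ.m+[n∸m]≡n (ℕ.≰⇒> n≰m)) (begin
  lengthSeriesUpTo (suc m) w (suc m ℕ.+ k)
    ≡⟨ ∑-↭ (w ∘ length) (partitionsUpTo-suc m k) ⟩
  ∑ (w ∘ length) (partitionsUpTo m (suc m ℕ.+ k) ++ map (suc m ∷_) (partitionsUpTo (suc m) k))
    ≡⟨ ∑-++ (w ∘ length) (partitionsUpTo m (suc m ℕ.+ k)) _ ⟩
  lengthSeriesUpTo m w (suc m ℕ.+ k) ℤ.+ ∑ (w ∘ length) (map (suc m ∷_) (partitionsUpTo (suc m) k))
    ≡⟨ cong (ℤ._+_ (lengthSeriesUpTo m w (suc m ℕ.+ k)))
         (trans (∑-map (w ∘ length) (suc m ∷_) (partitionsUpTo (suc m) k))
                (sym (shift-+ (suc m) (lengthSeriesUpTo (suc m) (w ∘ suc)) k))) ⟩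
  (lengthSeriesUpTo m w ⊕ shift (suc m) (lengthSeriesUpTo (suc m) (w ∘ suc))) (suc m ℕ.+ k)
    ∎)
  where
  open ≡-Reasoning
  k : ℕ
  k = n ℕ.∸ suc m

-- Product formulas modulo q ^ (1 + N)

-- cos n = Re iⁿ, sin n = Im iⁿ, ε n = (−1)ⁿ
cos sin ε one : Series
cos zero    = 1ℤ
cos (suc n) = ℤ.- sin n
sin zero    = 0ℤ
sin (suc n) = cos n
ε zero      = 1ℤ
ε (suc n)   = ℤ.- ε n
one _       = 1ℤ

ε-+ : ∀ a n → ε (a ℕ.+ n) ≡ ε a ℤ.* ε n
ε-+ zero    n = sym (ℤ.*-identityˡ (ε n))
ε-+ (suc a) n = trans (cong ℤ.-_ (ε-+ a n)) (ℤ.neg-distribˡ-* (ε a) (ε n))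

ε-double : ∀ n → ε (n ℕ.+ n) ≡ 1ℤ
ε-double zero    = refl
ε-double (suc n) = trans (cong (ℤ.-_ ∘ ε) (ℕ.+-suc n n)) (trans (ℤ.neg-involutive _) (ε-double n))

ε-odd : ∀ i → ε (odd i) ≡ -1ℤ
ε-odd i = cong ℤ.-_ (ε-double i)

ε-odd+ : ∀ i n → ε (odd i ℕ.+ n) ≡ ℤ.- ε n
ε-odd+ i n = trans (ε-+ (odd i) n) (trans (cong (ℤ._* ε n) (ε-odd i)) (ℤ.-1*i≡-i (ε n)))

ε-double+ : ∀ m n → ε (m ℕ.+ m ℕ.+ n) ≡ ε n
ε-double+ m n = trans (ε-+ (m ℕ.+ m) n) (trans (cong (ℤ._* ε n) (ε-double m)) (ℤ.*-identityˡ (ε n)))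

cos-double+ : ∀ m n → cos (m ℕ.+ m ℕ.+ n) ≡ ε m ℤ.* cos n
cos-double+ zero    n = sym (ℤ.*-identityˡ (cos n))
cos-double+ (suc m) n = trans (cong (λ k → cos (suc k ℕ.+ n)) (ℕ.+-suc m m))
  (trans (cong ℤ.-_ (cos-double+ m n)) (ℤ.neg-distribˡ-* (ε m) (cos n)))

cos-double-odd+ : ∀ i n → cos (odd i ℕ.+ odd i ℕ.+ n) ≡ ℤ.- cos n
cos-double-odd+ i n = trans (cos-double+ (odd i) n)
  (trans (cong (ℤ._* cos n) (ε-odd i)) (ℤ.-1*i≡-i (cos n)))

shift-⊖ : ∀ a f → shift a (⊖ f) ≗ ⊖ (shift a f)
shift-⊖ zero    f n       = refl
shift-⊖ (suc a) f zero    = refl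
shift-⊖ (suc a) f (suc n) = shift-⊖ a f n

shift-cong : ∀ a {f g} → f ≗ g → shift a f ≗ shift a g
shift-cong zero    f≗g n       = f≗g n
shift-cong (suc a) f≗g zero    = refl
shift-cong (suc a) f≗g (suc n) = shift-cong a f≗g n

shift-shift : ∀ a b f → shift a (shift b f) ≗ shift (a ℕ.+ b) f
shift-shift zero    b f n       = refl
shift-shift (suc a) b f zero    = refl
shift-shift (suc a) b f (suc n) = shift-shift a b f n

shift-⊕ : ∀ a f g → shift a (f ⊕ g) ≗ shift a f ⊕ shift a g
shift-⊕ zero    f g n       = refl
shift-⊕ (suc a) f g zero    = refl
shift-⊕ (suc a) f g (suc n) = shift-⊕ a f g n

shift-⊙ : ∀ a {θ φ} → (∀ n → θ (a ℕ.+ n) ≡ φ n) → ∀ g → shift a (φ ⊙ g) ≗ θ ⊙ shift a g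
shift-⊙ zero    θ≡φ g n       = cong (ℤ._* g n) (sym (θ≡φ n))
shift-⊙ (suc a) {θ} θ≡φ g zero    = sym (ℤ.*-zeroʳ (θ 0))
shift-⊙ (suc a) {θ} θ≡φ g (suc n) = shift-⊙ a {θ ∘ suc} θ≡φ g n

shift-⊙-neg : ∀ a θ → (∀ n → θ (a ℕ.+ n) ≡ ℤ.- θ n) → ∀ g → shift a (θ ⊙ g) ≗ θ ⊙ ⊖ (shift a g)
shift-⊙-neg a θ θ≡ g n = begin
  -- The product is rewritten as `(−θ) (−g)` because `−θ` is the weight that the shift turns into
  -- `θ`.
  shift a (θ ⊙ g) n              ≡⟨ shift-cong a (λ i → double-neg (θ i) (g i)) n ⟩
  shift a (⊖ θ ⊙ ⊖ g) n          ≡⟨ shift-⊙ a {θ} θ≡ (⊖ g) n ⟩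
  θ n ℤ.* shift a (⊖ g) n        ≡⟨ cong (ℤ._*_ (θ n)) (shift-⊖ a g n) ⟩
  θ n ℤ.* ℤ.- shift a g n        ∎
  where
  open ≡-Reasoning
  double-neg : ∀ x y → x ℤ.* y ≡ ℤ.- x ℤ.* ℤ.- y
  double-neg = solve-∀

shift-mono : ∀ a {f g} → (∀ n → f n ℤ.≤ g n) → ∀ n → shift a f n ℤ.≤ shift a g n
shift-mono zero    f≤g n       = f≤g n
shift-mono (suc a) f≤g zero    = ℤ.≤-refl
shift-mono (suc a) f≤g (suc n) = shift-mono a f≤g n

-- A shift by at least one reads `f` only below `n`, which is what the strong induction in
-- `NonNeg-cancel` can offer.
shift-nonneg-< : ∀ a f n → (∀ i → i ℕ.< n → 0ℤ ℤ.≤ f i) → 0ℤ ℤ.≤ shift (suc a) f n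
shift-nonneg-< a       f zero    _  = ℤ.≤-refl
shift-nonneg-< zero    f (suc n) 0≤ = 0≤ n ℕ.≤-refl
shift-nonneg-< (suc a) f (suc n) 0≤ = shift-nonneg-< a f n (λ i i<n → 0≤ i (ℕ.m≤n⇒m≤1+n i<n))

shift-nonneg : ∀ a {f} → (∀ n → 0ℤ ℤ.≤ f n) → ∀ n → 0ℤ ℤ.≤ shift a f n
shift-nonneg zero    0≤f n       = 0≤f n
shift-nonneg (suc a) 0≤f zero    = ℤ.≤-refl
shift-nonneg (suc a) 0≤f (suc n) = shift-nonneg a 0≤f n

q⊛ : ∀ f → q ⊛ f ≗ shift 1 f
q⊛ f zero    = ℤ.*-zeroˡ (f 0)
q⊛ f (suc n) = trans (cong (ℤ._+ (1̂ ⊛ f) n) (ℤ.*-zeroˡ (f (suc n))))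
  (trans (ℤ.+-identityˡ _) (⊛-identityˡ f n))

lengthSeriesUpTo-⊖ : ∀ m w → lengthSeriesUpTo m (⊖ w) ≗ ⊖ (lengthSeriesUpTo m w)
lengthSeriesUpTo-⊖ m w n = ∑-neg (partitionsUpTo m n)
  where
  ∑-neg : ∀ (xs : List (List ℕ)) → ∑ (⊖ w ∘ length) xs ≡ ℤ.- ∑ (w ∘ length) xs
  ∑-neg []       = refl
  ∑-neg (x ∷ xs) = trans (cong (ℤ._+_ (ℤ.- w (length x))) (∑-neg xs)) (sym (ℤ.neg-distrib-+ (w (length x)) _))

-- As infinite products, `C + i S = 1 / (iq; q)`, `E = 1 / (−q; q)` and `P = 1 / (q; q)`; `X` is the
-- norm of `C + i S`.
C S E P X : Series
C = lengthSeries cos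
S = lengthSeries sin
E = lengthSeries ε
P = lengthSeries one
X = C ⊛ C ⊕ S ⊛ S

module Truncated (N : ℕ) where
  open CommutativeRing (truncatedRing N) hiding (zero)
    renaming (refl to ≈-refl; sym to ≈-sym; trans to ≈-trans)
  open Products (truncatedRing N) public
  open import Relation.Binary.Reasoning.Setoid setoid

  private
    pointwise : ∀ {f g} → f ≗ g → f ≈ g
    pointwise f≗g n _ = f≗g n

  q^⊛ : ∀ a f → q ^ a ⊛ f ≗ shift a f
  q^⊛ zero    f n = ⊛-identityˡ f n
  q^⊛ (suc a) f n = trans (⊛-assoc q (q ^ a) f n) (trans (q⊛ (q ^ a ⊛ f) n)
    (trans (shift-cong 1 (q^⊛ a f) n) (shift-shift 1 a f n)))

  q^[1+N]≈0 : q ^ suc N ≈ 0#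
  q^[1+N]≈0 n n≤N = trans (sym (trans (⊛-comm (q ^ suc N) 1̂ n) (⊛-identityˡ (q ^ suc N) n)))
    (trans (q^⊛ (suc N) 1̂ n) (shift-< 1̂ (s≤s n≤N)))

  [1+q^]⊛ : ∀ a f → (1# + q ^ a) * f ≈ f ⊕ shift a f
  [1+q^]⊛ a f = ≈-trans (distribʳ f 1# (q ^ a)) (+-cong (*-identityˡ f) (pointwise (q^⊛ a f)))

  [1−q^]⊛ : ∀ a f → (1# - q ^ a) * f ≈ f ⊕ ⊖ (shift a f)
  [1−q^]⊛ a f = ≈-trans (distribʳ f 1# (- q ^ a)) (+-cong (*-identityˡ f)
    (≈-trans (≈-sym (-‿distribˡ-* (q ^ a) f)) (-‿cong (pointwise (q^⊛ a f)))))
    where open import Algebra.Properties.Ring ring using (-‿distribˡ-*)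

  module _ (w : ℕ → ℤ) where
    recurrence : ∀ m {v} → lengthSeriesUpTo (suc m) (w ∘ suc) ≗ v →
      lengthSeriesUpTo (suc m) w ≈ lengthSeriesUpTo m w ⊕ shift (suc m) v
    recurrence m e n _ = trans (lengthSeriesUpTo-suc m w n)
      (cong (ℤ._+_ (lengthSeriesUpTo m w n)) (shift-cong (suc m) e n))

    initial : ∀ {u} → w 0 ≡ u → lengthSeriesUpTo 0 w ≈ (λ n → u ℤ.* 1̂ n)
    initial refl n _ = lengthSeriesUpTo-zero w n

  -- An added part leaves the weight 1 unchanged, so passing from parts up to `m` to parts up to
  -- `m + 1` is division by `1 − q ^ (m + 1)`. Below `q ^ (1 + N)`, parts up to `N` are all that
  -- occur.
  DP≈1 : D q N * P ≈ 1#
  DP≈1 = ≈-trans (*-congˡ {D q N} (≈-sym (lengthSeriesUpTo≡lengthSeries N one)))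
    (∏-telescope {λ i → 1# - q ^ suc i} {λ m → lengthSeriesUpTo m one} (≈-trans (initial one refl) (λ n _ → ℤ.*-identityˡ (1̂ n))) step N)
    where
    cancel : ∀ a b → a ℤ.+ b ℤ.+ ℤ.- b ≡ a
    cancel = solve-∀
    step : ∀ m → (1# - q ^ suc m) * lengthSeriesUpTo (suc m) one ≈ lengthSeriesUpTo m one
    step m = ≈-trans ([1−q^]⊛ (suc m) _) (λ n n≤N →
      trans (cong (ℤ._+ (⊖ (shift (suc m) (lengthSeriesUpTo (suc m) one))) n) (recurrence one m (λ _ → refl) n n≤N))
        (cancel (lengthSeriesUpTo m one n) _))

  -- As for `DP≈1`, except that an added part flips the sign of the weight and the factor becomes
  -- `1 + q ^ (m + 1)`.
  BE≈1 : B q N * E ≈ 1#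
  BE≈1 = ≈-trans (*-congˡ {B q N} (≈-sym (lengthSeriesUpTo≡lengthSeries N ε)))
    (∏-telescope {λ i → 1# + q ^ suc i} {λ m → lengthSeriesUpTo m ε} (≈-trans (initial ε refl) (λ n _ → ℤ.*-identityˡ (1̂ n))) step N)
    where
    cancel : ∀ a b → a ℤ.+ ℤ.- b ℤ.+ b ≡ a
    cancel = solve-∀
    step : ∀ m → (1# + q ^ suc m) * lengthSeriesUpTo (suc m) ε ≈ lengthSeriesUpTo m ε
    step m = ≈-trans ([1+q^]⊛ (suc m) _) (λ n n≤N →
      trans (cong (ℤ._+ (shift (suc m) (lengthSeriesUpTo (suc m) ε)) n)
        (trans (recurrence ε m (lengthSeriesUpTo-⊖ (suc m) ε) n n≤N)
               (cong (ℤ._+_ (lengthSeriesUpTo m ε n)) (shift-⊖ (suc m) _ n))))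
        (cancel (lengthSeriesUpTo m ε n) _))

  -- An added part multiplies `iˡ` by `i`, so the recurrences of `C′` and `S′` are coupled: going
  -- back from `m + 1` to `m` is multiplication of `C′ + i S′` by `1 − i q ^ (m + 1)`, of norm
  -- `1 + q ^ (2m + 2)`.
  BX≈1 : B (q * q) N * X ≈ 1#
  BX≈1 = ≈-trans (*-congˡ {B (q * q) N} (+-cong
      (*-cong (≈-sym (lengthSeriesUpTo≡lengthSeries N cos)) (≈-sym (lengthSeriesUpTo≡lengthSeries N cos)))
      (*-cong (≈-sym (lengthSeriesUpTo≡lengthSeries N sin)) (≈-sym (lengthSeriesUpTo≡lengthSeries N sin)))))
    (∏-telescope {λ i → 1# + (q * q) ^ suc i} {X′} X′₀≈1 step N)
    where
    C′ S′ X′ : ℕ → Series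
    C′ m = lengthSeriesUpTo m cos
    S′ m = lengthSeriesUpTo m sin
    X′ m = C′ m * C′ m + S′ m * S′ m
    C′₀≈1 : C′ 0 ≈ 1#
    C′₀≈1 = ≈-trans (initial cos refl) (λ n _ → ℤ.*-identityˡ (1̂ n))
    S′₀≈0 : S′ 0 ≈ 0#
    S′₀≈0 = ≈-trans (initial sin refl) (λ n _ → ℤ.*-zeroˡ (1̂ n))
    X′₀≈1 : X′ 0 ≈ 1#
    X′₀≈1 = ≈-trans (+-cong (≈-trans (*-cong C′₀≈1 C′₀≈1) (*-identityˡ 1#))
      (≈-trans (*-cong S′₀≈0 S′₀≈0) (zeroˡ 0#))) (+-identityʳ 1#)
    cancel : ∀ a b → a ≡ a ℤ.+ ℤ.- b ℤ.+ b
    cancel = solve-∀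
    C′-step : ∀ m → C′ m ≈ C′ (suc m) + q ^ suc m * S′ (suc m)
    C′-step m n n≤N = trans (cancel (C′ m n) (shift (suc m) (S′ (suc m)) n)) (cong₂ ℤ._+_
      (sym (trans (recurrence cos m (lengthSeriesUpTo-⊖ (suc m) sin) n n≤N)
                  (cong (ℤ._+_ (C′ m n)) (shift-⊖ (suc m) _ n))))
      (sym (q^⊛ (suc m) (S′ (suc m)) n)))
    S′-step : ∀ m → S′ (suc m) ≈ S′ m + q ^ suc m * C′ (suc m)
    S′-step m = ≈-trans (recurrence sin m (λ _ → refl)) (λ n _ →
      cong (ℤ._+_ (S′ m n)) (sym (q^⊛ (suc m) (C′ (suc m)) n)))
    step : ∀ m → (1# + (q * q) ^ suc m) * X′ (suc m) ≈ X′ m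
    step m = ≈-trans (*-congʳ {X′ (suc m)} (+-congˡ {1#} (x²^n≈x^n∙x^n q (suc m))))
      (sum-of-squares-step (q ^ suc m) {C′ (suc m)} {S′ (suc m)} {C′ m} {S′ m} (C′-step m) (S′-step m))

  open CrankSeries {q} {N} {P} {E} {X} q^[1+N]≈0 DP≈1 BE≈1 BX≈1 public

  -- Replaces the substitutions q ↦ −q (θ = ε) and q ↦ iq (θ = cos), one factor of a product at a time.
  Twist : Series → Series → Series → Set
  Twist θ h h′ = ∀ g → h * (θ ⊙ g) ≈ θ ⊙ (h′ * g)

  ⊙-congˡ : ∀ θ {f g} → f ≈ g → θ ⊙ f ≈ θ ⊙ g
  ⊙-congˡ θ f≈g n n≤N = cong (ℤ._*_ (θ n)) (f≈g n n≤N)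

  Twist-cong : ∀ {θ h k h′ k′} → h ≈ k → h′ ≈ k′ → Twist θ k k′ → Twist θ h h′
  Twist-cong {θ} {h} {k} {h′} {k′} h≈k h′≈k′ t g = begin
    h * (θ ⊙ g)    ≈⟨ *-congʳ {θ ⊙ g} h≈k ⟩
    k * (θ ⊙ g)    ≈⟨ t g ⟩
    θ ⊙ (k′ * g)   ≈⟨ ⊙-congˡ θ (*-congʳ {g} h′≈k′) ⟨
    θ ⊙ (h′ * g)   ∎

  -- The universally quantified `g` in `Twist` absorbs the second factor. Thus twists compose
  -- although `θ` need not be multiplicative, as `cos` is not.
  Twist-* : ∀ {θ h k h′ k′} → Twist θ h h′ → Twist θ k k′ → Twist θ (h * k) (h′ * k′)
  Twist-* {θ} {h} {k} {h′} {k′} t u g = begin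
    h * k * (θ ⊙ g)      ≈⟨ *-assoc h k (θ ⊙ g) ⟩
    h * (k * (θ ⊙ g))    ≈⟨ *-congˡ {h} (u g) ⟩
    h * (θ ⊙ (k′ * g))   ≈⟨ t (k′ * g) ⟩
    θ ⊙ (h′ * (k′ * g))  ≈⟨ ⊙-congˡ θ (*-assoc h′ k′ g) ⟨
    θ ⊙ (h′ * k′ * g)    ∎

  Twist-1 : ∀ {θ} → Twist θ 1# 1#
  Twist-1 {θ} g = ≈-trans (*-identityˡ (θ ⊙ g)) (⊙-congˡ θ (≈-sym (*-identityˡ g)))

  Twist-∏ : ∀ {θ h h′} → (∀ i → Twist θ (h i) (h′ i)) → ∀ m → Twist θ (∏ h m) (∏ h′ m)
  Twist-∏ {θ} t zero    = Twist-1 {θ}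
  Twist-∏ {θ} {h} {h′} t (suc m) = Twist-* {θ} {h m} {∏ h m} {h′ m} {∏ h′ m} (t m) (Twist-∏ {θ} {h} {h′} t m)

  module _ {θ : Series} (a : ℕ) where

    Twist-neg : (∀ n → θ (a ℕ.+ n) ≡ ℤ.- θ n) → Twist θ (1# - q ^ a) (1# + q ^ a)
    Twist-neg θ≡ g = begin
      (1# - q ^ a) * (θ ⊙ g)             ≈⟨ [1−q^]⊛ a (θ ⊙ g) ⟩
      θ ⊙ g ⊕ ⊖ (shift a (θ ⊙ g))        ≈⟨ pointwise (λ n → trans
                                              (cong (λ t → θ n ℤ.* g n ℤ.+ ℤ.- t) (shift-⊙-neg a θ θ≡ g n))
                                              (factor (θ n) (g n) _)) ⟩
      θ ⊙ (g ⊕ shift a g)                ≈⟨ ⊙-congˡ θ ([1+q^]⊛ a g) ⟨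
      θ ⊙ ((1# + q ^ a) * g)             ∎
      where
      factor : ∀ t x y → t ℤ.* x ℤ.+ ℤ.- (t ℤ.* ℤ.- y) ≡ t ℤ.* (x ℤ.+ y)
      factor = solve-∀

    Twist-neg′ : (∀ n → θ (a ℕ.+ n) ≡ ℤ.- θ n) → Twist θ (1# + q ^ a) (1# - q ^ a)
    Twist-neg′ θ≡ g = begin
      (1# + q ^ a) * (θ ⊙ g)             ≈⟨ [1+q^]⊛ a (θ ⊙ g) ⟩
      θ ⊙ g ⊕ shift a (θ ⊙ g)            ≈⟨ pointwise (λ n → trans
                                              (cong (ℤ._+_ (θ n ℤ.* g n)) (shift-⊙-neg a θ θ≡ g n))
                                              (sym (ℤ.*-distribˡ-+ (θ n) (g n) _))) ⟩
      θ ⊙ (g ⊕ ⊖ (shift a g))            ≈⟨ ⊙-congˡ θ ([1−q^]⊛ a g) ⟨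
      θ ⊙ ((1# - q ^ a) * g)             ∎

    Twist-id : (∀ n → θ (a ℕ.+ n) ≡ θ n) → Twist θ (1# - q ^ a) (1# - q ^ a)
    Twist-id θ≡ g = begin
      (1# - q ^ a) * (θ ⊙ g)             ≈⟨ [1−q^]⊛ a (θ ⊙ g) ⟩
      θ ⊙ g ⊕ ⊖ (shift a (θ ⊙ g))        ≈⟨ pointwise (λ n → trans
                                              (cong (λ t → θ n ℤ.* g n ℤ.+ ℤ.- t) (shift-⊙ a {θ} θ≡ g n))
                                              (factor (θ n) (g n) _)) ⟩
      θ ⊙ (g ⊕ ⊖ (shift a g))            ≈⟨ ⊙-congˡ θ ([1−q^]⊛ a g) ⟨
      θ ⊙ ((1# - q ^ a) * g)             ∎
      where
      factor : ∀ t x y → t ℤ.* x ℤ.+ ℤ.- (t ℤ.* y) ≡ t ℤ.* (x ℤ.+ ℤ.- y)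
      factor = solve-∀

  -- Take `g = 1`; the condition on `θ 0` makes the twisted constant series 1 again.
  Twist⇒≈ : ∀ {θ h h′} → θ 0 ≡ 1ℤ → Twist θ h h′ → h ≈ θ ⊙ h′
  Twist⇒≈ {θ} {h} {h′} θ₀≡1 t = begin
    h               ≈⟨ *-identityʳ h ⟨
    h * 1#          ≈⟨ *-congˡ {h} (pointwise θ⊙1≗1) ⟨
    h * (θ ⊙ 1#)    ≈⟨ t 1# ⟩
    θ ⊙ (h′ * 1#)   ≈⟨ ⊙-congˡ θ (*-identityʳ h′) ⟩
    θ ⊙ h′          ∎
    where
    θ⊙1≗1 : θ ⊙ 1̂ ≗ 1̂
    θ⊙1≗1 zero    = trans (ℤ.*-identityʳ (θ 0)) θ₀≡1
    θ⊙1≗1 (suc n) = ℤ.*-zeroʳ (θ (suc n))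

  E*E≈ε⊙O⁺² : E * E ≈ ε ⊙ (O⁺ q N * O⁺ q N)
  E*E≈ε⊙O⁺² = ≈-trans (*-cong E≈O E≈O)
    (Twist⇒≈ {ε} {O q N * O q N} refl (Twist-* {ε} {O q N} {O q N} {O⁺ q N} {O⁺ q N} t t))
    where
    t : Twist ε (O q N) (O⁺ q N)
    t = Twist-∏ {ε} (λ i → Twist-neg {ε} (odd i) (ε-odd+ i)) N

  -- The exponents in `(q²; q⁴)` are twice odd numbers, so `q ↦ iq` changes the sign of each of
  -- these powers of `q`.
  X≈cos⊙O⁺ : X ≈ cos ⊙ O⁺ (q * q) N
  X≈cos⊙O⁺ = ≈-trans X≈O (Twist⇒≈ {cos} {O (q * q) N} refl
    (Twist-∏ {cos} (λ i → Twist-cong {cos} (+-congˡ {1#} (-‿cong (x²^n≈x^[n+n] q (odd i)))) (+-congˡ {1#} (x²^n≈x^[n+n] q (odd i)))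
      (Twist-neg {cos} (odd i ℕ.+ odd i) (cos-double-odd+ i))) N))

  private
    e₄ : ℕ → ℕ
    e₄ n = n ℕ.+ n ℕ.+ (n ℕ.+ n)

    x⁴^n : ∀ n → (q * q * (q * q)) ^ n ≈ q ^ e₄ n
    x⁴^n n = ≈-trans (x²^n≈x^[n+n] (q * q) n) (x²^n≈x^[n+n] q (n ℕ.+ n))

  -- Both sides are inverse to `D₄ * O⁺ q N`: under `q ↦ −q` the exponents of `D₄`, multiples of 4,
  -- keep their sign, and `O⁺` becomes `O`.
  E²P≈ε⊙XP : E * E * P ≈ ε ⊙ (X * P)
  E²P≈ε⊙XP = ≈-sym (inverse-unique {ε ⊙ (X * P)} {D₄ * O⁺ q N}
    (begin
      ε ⊙ (X * P) * (D₄ * O⁺ q N)     ≈⟨ *-comm (ε ⊙ (X * P)) (D₄ * O⁺ q N) ⟩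
      D₄ * O⁺ q N * (ε ⊙ (X * P))     ≈⟨ Twist-* {ε} {D₄} {O⁺ q N} {D₄} {O q N} tD tO (X * P) ⟩
      ε ⊙ (D₄ * O q N * (X * P))      ≈⟨ ⊙-congˡ ε (≈-trans (*-assoc D₄ (O q N) (X * P)) D₄O∙XP≈1) ⟩
      ε ⊙ 1#                          ≈⟨ Twist⇒≈ {ε} refl (Twist-1 {ε}) ⟨
      1#                              ∎)
    (≈-trans (*-assoc D₄ (O⁺ q N) (E * E * P)) D₄O⁺∙E²P≈1))
    where
    tO : Twist ε (O⁺ q N) (O q N)
    tO = Twist-∏ {ε} (λ i → Twist-neg′ {ε} (odd i) (ε-odd+ i)) N
    tD : Twist ε D₄ D₄
    tD = Twist-∏ {ε} (λ i → Twist-cong {ε} (+-congˡ {1#} (-‿cong (x⁴^n (suc i)))) (+-congˡ {1#} (-‿cong (x⁴^n (suc i))))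
      (Twist-id {ε} (e₄ (suc i)) (ε-double+ (suc i ℕ.+ suc i)))) N

  -- Nonnegativity and positivity of coefficients

  NonNeg : Series → Set
  NonNeg f = ∀ n → n ℕ.≤ N → 0ℤ ℤ.≤ f n

  NonNeg-resp : ∀ {f g} → f ≈ g → NonNeg f → NonNeg g
  NonNeg-resp f≈g 0≤f n n≤N = subst (0ℤ ℤ.≤_) (f≈g n n≤N) (0≤f n n≤N)

  private
    undo : ∀ {g} f a → (1# - q ^ a) * f ≈ g → f ≈ g ⊕ shift a f
    undo f a e n n≤N = trans (sym (cancel (f n) (shift a f n)))
      (cong (ℤ._+ shift a f n) (trans (sym ([1−q^]⊛ a f n n≤N)) (e n n≤N)))
      where
      cancel : ∀ x y → x ℤ.+ ℤ.- y ℤ.+ y ≡ x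
      cancel = solve-∀

  -- If `g` is the product, then `f = g + q ^ (a + 1) f` expresses each coefficient of `f` by one of
  -- `g` and an earlier one of `f`; `below` is the resulting strong induction.
  NonNeg-cancel : ∀ a f → NonNeg ((1# - q ^ suc a) * f) → NonNeg f
  NonNeg-cancel a f 0≤g n = below (suc n) n ℕ.≤-refl
    where
    below : ∀ k i → i ℕ.< k → i ℕ.≤ N → 0ℤ ℤ.≤ f i
    below (suc k) i (s≤s i≤k) i≤N = subst (0ℤ ℤ.≤_) (sym (undo f (suc a) ≈-refl i i≤N))
      (ℤ.+-mono-≤ (0≤g i i≤N) (shift-nonneg-< a f i λ j j<i →
        below k j (ℕ.<-≤-trans j<i i≤k) (ℕ.≤-trans (ℕ.<⇒≤ j<i) i≤N)))

  -- The last `m` factors are divided out and the first `j` remain: `j = 0` clears the product,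
  -- `j = 1` leaves the factor `1 − q` that `positive` asks for.
  NonNeg-cancel-∏ : ∀ h (e : ℕ → ℕ) → (∀ i → h i ≈ 1# - q ^ suc (e i)) → ∀ j m f →
    NonNeg (∏ h (m ℕ.+ j) * f) → NonNeg (∏ h j * f)
  NonNeg-cancel-∏ h e h≈ j zero    f 0≤ = 0≤
  NonNeg-cancel-∏ h e h≈ j (suc m) f 0≤ = NonNeg-cancel-∏ h e h≈ j m f
    (NonNeg-cancel (e (m ℕ.+ j)) (∏ h (m ℕ.+ j) * f)
      (NonNeg-resp (≈-trans (*-assoc (h (m ℕ.+ j)) (∏ h (m ℕ.+ j)) f)
                            (*-congʳ {∏ h (m ℕ.+ j) * f} (h≈ (m ℕ.+ j)))) 0≤))

  -- The coefficients of `(1 − q) f` are the successive differences of `f`, so `f` is weakly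
  -- increasing from its value 1 at 0.
  positive : ∀ f → f 0 ≡ 1ℤ → NonNeg ((1# - q ^ 1) * f) → ∀ n → n ℕ.≤ N → 0ℤ ℤ.< f n
  positive f f₀≡1 0≤g zero    _   = subst (0ℤ ℤ.<_) (sym f₀≡1) (ℤ.+<+ (s≤s z≤n))
  positive f f₀≡1 0≤g (suc n) n<N = subst (0ℤ ℤ.<_) (sym (undo f 1 ≈-refl (suc n) n<N))
    (ℤ.+-mono-≤-< (0≤g (suc n) n<N) (positive f f₀≡1 0≤g n (ℕ.≤-trans (ℕ.n≤1+n n) n<N)))

  NonNeg-1 : NonNeg 1#
  NonNeg-1 zero    _ = ℤ.+≤+ z≤n
  NonNeg-1 (suc n) _ = ℤ.≤-refl

  first-factor : ∀ h f → ∏ h 1 * f ≈ h 0 * f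
  first-factor h f = *-congʳ {f} (*-identityʳ (h 0))


  private
    NonNeg-O*XP : NonNeg (O q N * (X * P))
    NonNeg-O*XP = NonNeg-resp (*-identityˡ (O q N * (X * P)))
      -- The second function is `4 (i + 1) − 1`, since the lemma adds 1 to each exponent.
      (NonNeg-cancel-∏ (λ i → 1# - (q * q * (q * q)) ^ suc i) (λ i → i ℕ.+ suc i ℕ.+ (suc i ℕ.+ suc i)) (λ i → +-congˡ {1#} (-‿cong (x⁴^n (suc i)))) 0 N (O q N * (X * P))
        (NonNeg-resp (≈-sym (≈-trans
          (pointwise (λ n → cong (λ k → (D (q * q * (q * q)) k * (O q N * (X * P))) n) (ℕ.+-identityʳ N)))
          D₄O∙XP≈1)) NonNeg-1))

  -- All factors of `O q N` but `1 − q` are divided out of the nonnegative series `O q N * (X * P)`.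
  -- Writing `N` as `k + 1` ensures that this first factor is there to be kept.
  XP-positive′ : ∀ k → k ℕ.+ 1 ≡ N → ∀ n → n ℕ.≤ N → 0ℤ ℤ.< (X * P) n
  XP-positive′ k refl = positive (X * P) refl
    (NonNeg-resp (first-factor (λ i → 1# - q ^ odd i) (X * P))
      (NonNeg-cancel-∏ (λ i → 1# - q ^ odd i) (λ i → i ℕ.+ i) (λ _ → ≈-refl) 1 k (X * P) NonNeg-O*XP))

  P-positive′ : ∀ k → k ℕ.+ 1 ≡ N → ∀ n → n ℕ.≤ N → 0ℤ ℤ.< P n
  P-positive′ k refl = positive P refl
    (NonNeg-resp (first-factor (λ i → 1# - q ^ suc i) P)
      (NonNeg-cancel-∏ (λ i → 1# - q ^ suc i) (λ i → i) (λ _ → ≈-refl) 1 k P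
        (NonNeg-resp (≈-sym DP≈1) NonNeg-1)))

XP-positive : ∀ n → 0ℤ ℤ.< (X ⊛ P) n
XP-positive n = Truncated.XP-positive′ (n ℕ.+ 1) n refl n (ℕ.m≤m+n n 1)

P-positive : ∀ n → 0ℤ ℤ.< P n
P-positive n = Truncated.P-positive′ (n ℕ.+ 1) n refl n (ℕ.m≤m+n n 1)

E²P≗ε⊙XP : E ⊛ E ⊛ P ≗ ε ⊙ (X ⊛ P)
E²P≗ε⊙XP n = Truncated.E²P≈ε⊙XP n n ℕ.≤-refl

-- Coefficients of X and E²

-- Coefficients of `(−q²; q⁴)` and `(−q; q²)²` with `i` factors. With `y = q ^ odd i`, the factor
-- `(1 + y)²` is grouped as `(1 + y²) + 2 y` for the comparison with `1 + y²`.
distinctTwiceOdd distinctOddPairs : ℕ → Series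
distinctTwiceOdd zero    = 1̂
distinctTwiceOdd (suc i) = distinctTwiceOdd i ⊕ shift (odd i ℕ.+ odd i) (distinctTwiceOdd i)
distinctOddPairs zero    = 1̂
distinctOddPairs (suc i) = (U ⊕ shift (odd i ℕ.+ odd i) U) ⊕ (shift (odd i) U ⊕ shift (odd i) U)
  where
  U : Series
  U = distinctOddPairs i

private
  T U : ℕ → Series
  T = distinctTwiceOdd
  U = distinctOddPairs

module _ {N : ℕ} where
  open Truncated N
  open CommutativeRing (truncatedRing N) hiding (zero)
    renaming (refl to ≈-refl; sym to ≈-sym; trans to ≈-trans)

  O⁺q²≈distinctTwiceOdd : ∀ m → O⁺ (q * q) m ≈ distinctTwiceOdd m
  O⁺q²≈distinctTwiceOdd zero    = ≈-refl
  O⁺q²≈distinctTwiceOdd (suc i) = ≈-trans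
    (*-cong (+-congˡ {1#} (x²^n≈x^[n+n] q (odd i))) (O⁺q²≈distinctTwiceOdd i))
    ([1+q^]⊛ (odd i ℕ.+ odd i) (distinctTwiceOdd i))

  [O⁺q]²≈distinctOddPairs : ∀ m → O⁺ q m * O⁺ q m ≈ distinctOddPairs m
  [O⁺q]²≈distinctOddPairs m = ≈-trans (≈-sym (∏-distrib-* _ _ m)) (go m)
    where
    twice : ∀ a f → (1# + q ^ a) * (1# + q ^ a) * f ≈ (f ⊕ shift (a ℕ.+ a) f) ⊕ (shift a f ⊕ shift a f)
    twice a f = ≈-trans (*-assoc (1# + q ^ a) (1# + q ^ a) f)
      (≈-trans (*-congˡ {1# + q ^ a} ([1+q^]⊛ a f)) (≈-trans ([1+q^]⊛ a (f ⊕ shift a f)) λ n _ →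
        trans (cong (ℤ._+_ ((f ⊕ shift a f) n))
          (trans (shift-⊕ a f (shift a f) n) (cong (ℤ._+_ (shift a f n)) (shift-shift a a f n))))
          (rearrange (f n) (shift a f n) _)))
      where
      rearrange : ∀ x y z → x ℤ.+ y ℤ.+ (y ℤ.+ z) ≡ x ℤ.+ z ℤ.+ (y ℤ.+ y)
      rearrange = solve-∀
    go : ∀ m → ∏ (λ i → (1# + q ^ odd i) * (1# + q ^ odd i)) m ≈ distinctOddPairs m
    go zero    = ≈-refl
    go (suc i) = ≈-trans (*-congˡ {(1# + q ^ odd i) * (1# + q ^ odd i)} (go i)) (twice (odd i) (distinctOddPairs i))

-- The coefficient at `n` is read in the ring truncated at `n`, where `n` factors suffice; hence the
-- repeated `n`.
X≡cos*T : ∀ n → X n ≡ cos n ℤ.* T n n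
X≡cos*T n = trans (Truncated.X≈cos⊙O⁺ n n ℕ.≤-refl)
  (cong (ℤ._*_ (cos n)) (O⁺q²≈distinctTwiceOdd {n} n n ℕ.≤-refl))

E²≡ε*U : ∀ n → (E ⊛ E) n ≡ ε n ℤ.* U n n
E²≡ε*U n = trans (Truncated.E*E≈ε⊙O⁺² n n ℕ.≤-refl)
  (cong (ℤ._*_ (ε n)) ([O⁺q]²≈distinctOddPairs {n} n n ℕ.≤-refl))

0≤T : ∀ i n → 0ℤ ℤ.≤ T i n
0≤T zero    zero    = ℤ.+≤+ z≤n
0≤T zero    (suc n) = ℤ.≤-refl
0≤T (suc i) n       = ℤ.+-mono-≤ (0≤T i n) (shift-nonneg (odd i ℕ.+ odd i) (0≤T i) n)

-- Each stage multiplies `T` by `1 + y²` and `U` by `(1 + y²) + 2 y`, and the surplus `2 y`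
-- contributes nonnegative terms.
T≤U : ∀ i n → T i n ℤ.≤ U i n
0≤U : ∀ i n → 0ℤ ℤ.≤ U i n

0≤U i n = ℤ.≤-trans (0≤T i n) (T≤U i n)

T≤U zero    n = ℤ.≤-refl
T≤U (suc i) n = subst (ℤ._≤ U (suc i) n) (ℤ.+-identityʳ _)
  (ℤ.+-mono-≤ (ℤ.+-mono-≤ (T≤U i n) (shift-mono (odd i ℕ.+ odd i) (T≤U i) n))
              (ℤ.+-mono-≤ (0≤shift n) (0≤shift n)))
  where
  0≤shift : ∀ n → 0ℤ ℤ.≤ shift (odd i) (U i) n
  0≤shift = shift-nonneg (odd i) (0≤U i)

T-mono : ∀ {v n i j} → i ℕ.≤ j → v ℤ.< T i n → v ℤ.< T j n
T-mono i≤j v<T = go (ℕ.≤⇒≤′ i≤j) v<T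
  where
  go : ∀ {v n i j} → i ℕ.≤′ j → v ℤ.< T i n → v ℤ.< T j n
  go ℕ.≤′-refl v<T = v<T
  go {v} {n} {i} {suc j} (ℕ.≤′-step i≤j) v<T = subst (ℤ._< T (suc j) n) (ℤ.+-identityʳ v)
    (ℤ.+-mono-<-≤ (go i≤j v<T) (shift-nonneg (odd j ℕ.+ odd j) (0≤T j) n))

T<U-mono : ∀ {n i j} → i ℕ.≤ j → T i n ℤ.< U i n → T j n ℤ.< U j n
T<U-mono i≤j T<U = go (ℕ.≤⇒≤′ i≤j) T<U
  where
  go : ∀ {n i j} → i ℕ.≤′ j → T i n ℤ.< U i n → T j n ℤ.< U j n
  go ℕ.≤′-refl T<U = T<U
  go {n} {i} {suc j} (ℕ.≤′-step i≤j) T<U = subst (ℤ._< U (suc j) n) (ℤ.+-identityʳ _)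
    (ℤ.+-mono-<-≤ (ℤ.+-mono-<-≤ (go i≤j T<U) (shift-mono (odd j ℕ.+ odd j) (T≤U j) n))
                  (ℤ.+-mono-≤ (0≤shift n) (0≤shift n)))
    where
    0≤shift : ∀ n → 0ℤ ℤ.≤ shift (odd j) (U j) n
    0≤shift = shift-nonneg (odd j) (0≤U j)

T-suc-positive : ∀ i k → 0ℤ ℤ.< T i k → 0ℤ ℤ.< T (suc i) (odd i ℕ.+ odd i ℕ.+ k)
T-suc-positive i k 0<T = ℤ.+-mono-≤-< (0≤T i (odd i ℕ.+ odd i ℕ.+ k))
  (subst (0ℤ ℤ.<_) (sym (shift-+ (odd i ℕ.+ odd i) (T i) k)) 0<T)

-- Adding the part `2i + 1` to just one member of a pair with total `k` yields a pair counted by the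
-- cross term of `U`, which has no counterpart in `T`.
T<U-suc : ∀ i k → 0ℤ ℤ.< U i k → T (suc i) (odd i ℕ.+ k) ℤ.< U (suc i) (odd i ℕ.+ k)
T<U-suc i k 0<U = subst (ℤ._< U (suc i) n) (ℤ.+-identityʳ _)
  (ℤ.+-mono-≤-< (ℤ.+-mono-≤ (T≤U i n) (shift-mono (odd i ℕ.+ odd i) (T≤U i) n))
                (ℤ.+-mono-< 0<shift 0<shift))
  where
  n : ℕ
  n = odd i ℕ.+ k
  0<shift : 0ℤ ℤ.< shift (odd i) (U i) n
  0<shift = subst (0ℤ ℤ.<_) (sym (shift-+ (odd i) (U i) k)) 0<U

0<1 : 0ℤ ℤ.< 1ℤ
0<1 = ℤ.+<+ (s≤s z≤n)

T₀-positive : ∀ i → 0ℤ ℤ.< T i 0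
T₀-positive i = T-mono {n = 0} {0} {i} z≤n 0<1

U-positive : ∀ i {n} → T i n ℤ.< U i n → 0ℤ ℤ.< U i n
U-positive i {n} T<U = ℤ.≤-<-trans (0≤T i n) T<U

-- The single part `2 (2i + 1)` is such a partition.
T-2odd-positive : ∀ i {N} → suc i ℕ.≤ N → 0ℤ ℤ.< T N (odd i ℕ.+ odd i)
T-2odd-positive i i<N = T-mono i<N
  (subst (λ n → 0ℤ ℤ.< T (suc i) n) (ℕ.+-identityʳ (odd i ℕ.+ odd i)) (T-suc-positive i 0 (T₀-positive i)))

-- The parts used are 2 and 2 (2i+1), which are distinct for i = j + 1.
T-4n-positive : ∀ j {N} → let m = suc (suc j) ℕ.+ suc (suc j) in suc (suc j) ℕ.≤ N → 0ℤ ℤ.< T N (m ℕ.+ m)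
T-4n-positive j ≤N = T-mono ≤N (subst (λ n → 0ℤ ℤ.< T (suc (suc j)) n) (2odd+2 j)
  (T-suc-positive (suc j) 2 (T-2odd-positive 0 {suc j} (s≤s z≤n))))
  where
  2odd+2 : ∀ j → suc (suc j ℕ.+ suc j) ℕ.+ suc (suc j ℕ.+ suc j) ℕ.+ 2 ≡
    suc (suc j) ℕ.+ suc (suc j) ℕ.+ (suc (suc j) ℕ.+ suc (suc j))
  2odd+2 = ℕSolver.solve-∀

-- Of the pairs, ({2j+3}, {1}) is not of the form (λ, λ).
T<U-2m : ∀ j {N} → suc (suc j) ℕ.≤ N → let m = suc (suc j) in T N (m ℕ.+ m) ℤ.< U N (m ℕ.+ m)
T<U-2m j ≤N = T<U-mono ≤N (subst (λ n → T (suc (suc j)) n ℤ.< U (suc (suc j)) n) (odd+1 j)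
  (T<U-suc (suc j) 1 (U-positive (suc j) (T<U-mono {1} {1} {suc j} (s≤s z≤n) (T<U-suc 0 0 0<1)))))
  where
  odd+1 : ∀ j → suc (suc j ℕ.+ suc j) ℕ.+ 1 ≡ suc (suc j) ℕ.+ suc (suc j)
  odd+1 = ℕSolver.solve-∀

-- The single part `2i + 1` paired with the empty partition.
U-odd-positive : ∀ i {N} → suc i ℕ.≤ N → 0ℤ ℤ.< U N (odd i)
U-odd-positive i {N} i<N = U-positive N (T<U-mono i<N
  (subst (λ n → T (suc i) n ℤ.< U (suc i) n) (ℕ.+-identityʳ (odd i))
    (T<U-suc i 0 (ℤ.<-≤-trans (T₀-positive i) (T≤U i 0)))))

cos-double : ∀ m → cos (m ℕ.+ m) ≡ ε m
cos-double m = trans (cong cos (sym (ℕ.+-identityʳ (m ℕ.+ m)))) (trans (cos-double+ m 0) (ℤ.*-identityʳ (ε m)))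

cos-odd : ∀ i → cos (odd i) ≡ 0ℤ
cos-odd zero    = refl
cos-odd (suc i) = trans (cong (cos ∘ suc ∘ suc) (ℕ.+-suc i i)) (cong ℤ.-_ (cos-odd i))

X-double : ∀ m → X (m ℕ.+ m) ≡ ε m ℤ.* T (m ℕ.+ m) (m ℕ.+ m)
X-double m = trans (X≡cos*T (m ℕ.+ m)) (cong (ℤ._* T (m ℕ.+ m) (m ℕ.+ m)) (cos-double m))

E²-double : ∀ m → (E ⊛ E) (m ℕ.+ m) ≡ U (m ℕ.+ m) (m ℕ.+ m)
E²-double m = trans (E²≡ε*U (m ℕ.+ m))
  (trans (cong (ℤ._* U (m ℕ.+ m) (m ℕ.+ m)) (ε-double m)) (ℤ.*-identityˡ _))

-- The index is `4 (j + 2)`. Index 4 is left out because 4 is not a sum of distinct numbers among 2,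
-- 6, 10, ..., so that `X` vanishes there.
X-4n : ∀ j → let m = suc (suc j) ℕ.+ suc (suc j) in
  0ℤ ℤ.< X (m ℕ.+ m) × X (m ℕ.+ m) ℤ.< (E ⊛ E) (m ℕ.+ m)
X-4n j = subst (0ℤ ℤ.<_) (sym X≡T) (T-4n-positive j 2+j≤)
       , subst (ℤ._< (E ⊛ E) (m ℕ.+ m)) (sym X≡T)
           (subst (ℤ._<_ (T (m ℕ.+ m) (m ℕ.+ m))) (sym (E²-double m)) (T<U-2m (j ℕ.+ suc (suc j)) (ℕ.m≤m+n m m)))
  where
  m : ℕ
  m = suc (suc j) ℕ.+ suc (suc j)
  2+j≤ : suc (suc j) ℕ.≤ m ℕ.+ m
  2+j≤ = ℕ.≤-trans (ℕ.m≤m+n _ _) (ℕ.m≤m+n m m)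
  X≡T : X (m ℕ.+ m) ≡ T (m ℕ.+ m) (m ℕ.+ m)
  X≡T = trans (X-double m) (trans (cong (ℤ._* T (m ℕ.+ m) (m ℕ.+ m)) (ε-double (suc (suc j)))) (ℤ.*-identityˡ _))

-- Half of the index is odd, which gives the sign -1; the index itself serves as the single part
-- that makes `T` positive.
X-4n+2 : ∀ j → let m = odd (suc j) in
  X (m ℕ.+ m) ℤ.< 0ℤ × ℤ.- X (m ℕ.+ m) ℤ.< (E ⊛ E) (m ℕ.+ m)
X-4n+2 j = subst (ℤ._< 0ℤ) (sym X≡-T) (ℤ.neg-mono-< (T-2odd-positive (suc j) 2+j≤))
         , subst (ℤ._< (E ⊛ E) (m ℕ.+ m)) (sym (trans (cong ℤ.-_ X≡-T) (ℤ.neg-involutive _)))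
             (subst (ℤ._<_ (T (m ℕ.+ m) (m ℕ.+ m))) (sym (E²-double m)) (T<U-2m (j ℕ.+ suc j) (ℕ.m≤m+n m m)))
  where
  m : ℕ
  m = odd (suc j)
  2+j≤ : suc (suc j) ℕ.≤ m ℕ.+ m
  2+j≤ = ℕ.≤-trans (s≤s (ℕ.m≤m+n (suc j) (suc j))) (ℕ.m≤m+n m m)
  X≡-T : X (m ℕ.+ m) ≡ ℤ.- T (m ℕ.+ m) (m ℕ.+ m)
  X≡-T = trans (X-double m) (trans (cong (ℤ._* T (m ℕ.+ m) (m ℕ.+ m)) (ε-odd (suc j))) (ℤ.-1*i≡-i _))

X-odd : ∀ i → X (odd i) ≡ 0ℤ
X-odd i = trans (X≡cos*T (odd i)) (trans (cong (ℤ._* T (odd i) (odd i)) (cos-odd i)) (ℤ.*-zeroˡ (T (odd i) (odd i))))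

E²-odd : ∀ i → (E ⊛ E) (odd i) ℤ.< 0ℤ
E²-odd i = subst (ℤ._< 0ℤ) (sym E²≡-U) (ℤ.neg-mono-< (U-odd-positive i (s≤s (ℕ.m≤m+n i i))))
  where
  E²≡-U : (E ⊛ E) (odd i) ≡ ℤ.- U (odd i) (odd i)
  E²≡-U = trans (E²≡ε*U (odd i)) (trans (cong (ℤ._* U (odd i) (odd i)) (ε-odd i)) (ℤ.-1*i≡-i _))

-- Cranks modulo 4

indicator : ∀ {A : Set} → Dec A → ℤ
indicator a? = if does a? then 1ℤ else 0ℤ

length-filter : ∀ {A : Set} {P : A → Set} (P? : ∀ x → Dec (P x)) xs →
  + length (filter P? xs) ≡ ∑ (indicator ∘ P?) xs
length-filter P? []       = refl
length-filter P? (x ∷ xs) with P? x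
... | yes _ = cong (ℤ._+_ 1ℤ) (length-filter P? xs)
... | no _  = trans (length-filter P? xs) (sym (ℤ.+-identityˡ _))

residue : ℕ → ℤ → ℤ
residue r i = indicator (i ≡? + r [mod 4 ])

residue-+4 : ∀ r i → residue r (i ℤ.+ + 4) ≡ residue r i
residue-+4 r i = cong (λ b → if b then 1ℤ else 0ℤ) (does-⇔ (mk⇔ to from) ((i ℤ.+ + 4) ≡? + r [mod 4 ]) (i ≡? + r [mod 4 ]))
  where
  comm : ∀ i r → i ℤ.+ + 4 ℤ.- r ≡ i ℤ.- r ℤ.+ + 4
  comm = solve-∀
  to : (i ℤ.+ + 4) ≡ + r [mod 4 ] → i ≡ + r [mod 4 ]
  to 4∣ = ∣⇒∣ᵤ (∣m+n∣n⇒∣m {m = i ℤ.- + r} (subst (λ j → + 4 ∣ j) (comm i (+ r)) (∣ᵤ⇒∣ 4∣)) ∣-refl)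
  from : i ≡ + r [mod 4 ] → (i ℤ.+ + 4) ≡ + r [mod 4 ]
  from 4∣ = ∣⇒∣ᵤ (subst (λ j → + 4 ∣ j) (sym (comm i (+ r))) (∣m∣n⇒∣m+n {m = i ℤ.- + r} (∣ᵤ⇒∣ 4∣) ∣-refl))

-- Under these laws `F` is determined by `F a 0` and `F 0 b` for `a, b < 4`, so an identity between
-- two such functions reduces to eight computations.
record DependsOnDifferenceMod4 (F : ℕ → ℕ → ℤ) : Set where
  field
    both-suc : ∀ a b → F (suc a) (suc b) ≡ F a b
    +4ˡ      : ∀ a → F (4 ℕ.+ a) 0 ≡ F a 0
    +4ʳ      : ∀ b → F 0 (4 ℕ.+ b) ≡ F 0 b

open DependsOnDifferenceMod4

residue-difference : ∀ r → DependsOnDifferenceMod4 (λ a b → residue r (a ℤ.⊖ b))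
residue-difference r = record
  { both-suc = λ a b → cong (residue r) (ℤ.[1+m]⊖[1+n]≡m⊖n a b)
  ; +4ˡ      = λ a → trans (cong (residue r) (cong +_ (ℕ.+-comm 4 a))) (residue-+4 r (+ a))
  ; +4ʳ      = λ b → trans (sym (residue-+4 r (0 ℤ.⊖ (4 ℕ.+ b)))) (cong (residue r) (add-4 b))
  }
  where
  add-4 : ∀ b → (0 ℤ.⊖ (4 ℕ.+ b)) ℤ.+ + 4 ≡ 0 ℤ.⊖ b
  add-4 zero    = refl
  add-4 (suc b) = refl

+-difference : ∀ {F G} → DependsOnDifferenceMod4 F → DependsOnDifferenceMod4 G →
  DependsOnDifferenceMod4 (λ a b → F a b ℤ.+ G a b)
+-difference p p′ = record
  { both-suc = λ a b → cong₂ ℤ._+_ (both-suc p a b) (both-suc p′ a b)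
  ; +4ˡ      = λ a → cong₂ ℤ._+_ (+4ˡ p a) (+4ˡ p′ a)
  ; +4ʳ      = λ b → cong₂ ℤ._+_ (+4ʳ p b) (+4ʳ p′ b)
  }

-- The function is the real part of `i ^ (a − b)`.
cos-difference : DependsOnDifferenceMod4 (λ a b → cos a ℤ.* cos b ℤ.+ sin a ℤ.* sin b)
cos-difference = record
  { both-suc = λ a b → identity (cos a) (cos b) (sin a) (sin b)
  ; +4ˡ      = λ a → cong₂ ℤ._+_ (cong (ℤ._* 1ℤ) (ℤ.neg-involutive (cos a))) (cong (ℤ._* 0ℤ) (ℤ.neg-involutive (sin a)))
  ; +4ʳ      = λ b → cong₂ ℤ._+_ (cong (1ℤ ℤ.*_) (ℤ.neg-involutive (cos b))) (cong (0ℤ ℤ.*_) (ℤ.neg-involutive (sin b)))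
  }
  where
  identity : ∀ c c′ s s′ → ℤ.- s ℤ.* ℤ.- s′ ℤ.+ c ℤ.* c′ ≡ c ℤ.* c′ ℤ.+ s ℤ.* s′
  identity = solve-∀

-- The function is the imaginary part of `i ^ (a − b)`; the explicit factor -1 lets `∑-*ˡ` split
-- sums of it.
sin-difference : DependsOnDifferenceMod4 (λ a b → sin a ℤ.* cos b ℤ.+ -1ℤ ℤ.* (cos a ℤ.* sin b))
sin-difference = record
  { both-suc = λ a b → identity (cos a) (cos b) (sin a) (sin b)
  ; +4ˡ      = λ a → cong₂ ℤ._+_ (cong (ℤ._* 1ℤ) (ℤ.neg-involutive (sin a))) (cong (λ t → -1ℤ ℤ.* (t ℤ.* 0ℤ)) (ℤ.neg-involutive (cos a)))
  ; +4ʳ      = λ b → cong₂ ℤ._+_ (cong (0ℤ ℤ.*_) (ℤ.neg-involutive (cos b))) (cong (λ t → -1ℤ ℤ.* (1ℤ ℤ.* t)) (ℤ.neg-involutive (sin b)))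
  }
  where
  identity : ∀ c c′ s s′ → c ℤ.* ℤ.- s′ ℤ.+ -1ℤ ℤ.* (ℤ.- s ℤ.* c′) ≡ s ℤ.* c′ ℤ.+ -1ℤ ℤ.* (c ℤ.* s′)
  identity = solve-∀

ε-difference : DependsOnDifferenceMod4 (λ a b → ε a ℤ.* ε b)
ε-difference = record
  { both-suc = λ a b → identity (ε a) (ε b)
  ; +4ˡ      = λ a → cong (ℤ._* 1ℤ) (four-neg (ε a))
  ; +4ʳ      = λ b → cong (1ℤ ℤ.*_) (four-neg (ε b))
  }
  where
  identity : ∀ x y → ℤ.- x ℤ.* ℤ.- y ≡ x ℤ.* y
  identity = solve-∀
  four-neg : ∀ x → ℤ.- ℤ.- ℤ.- ℤ.- x ≡ x
  four-neg = solve-∀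

data Agree (f g : ℕ → ℤ) : Set where
  agree : f 0 ≡ g 0 → f 1 ≡ g 1 → f 2 ≡ g 2 → f 3 ≡ g 3 → Agree f g

agree-periodic : ∀ {f g} → (∀ n → f (4 ℕ.+ n) ≡ f n) → (∀ n → g (4 ℕ.+ n) ≡ g n) → Agree f g → f ≗ g
agree-periodic f4 g4 (agree e₀ e₁ e₂ e₃) = go
  where
  go : _ ≗ _
  go 0 = e₀
  go 1 = e₁
  go 2 = e₂
  go 3 = e₃
  go (suc (suc (suc (suc n)))) = trans (f4 n) (trans (go n) (sym (g4 n)))

agree-difference : ∀ {F G} → DependsOnDifferenceMod4 F → DependsOnDifferenceMod4 G →
  Agree (λ a → F a 0) (λ a → G a 0) → Agree (F 0) (G 0) → ∀ a b → F a b ≡ G a b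
agree-difference pF pG e e′ a       zero    = agree-periodic (+4ˡ pF) (+4ˡ pG) e a
agree-difference pF pG e e′ zero    (suc b) = agree-periodic (+4ʳ pF) (+4ʳ pG) e′ (suc b)
agree-difference pF pG e e′ (suc a) (suc b) =
  trans (both-suc pF a b) (trans (agree-difference pF pG e e′ a b) (sym (both-suc pG a b)))

-- The real part of `iᵈ` is 1, 0, -1, 0 for `d` congruent to 0, 1, 2, 3.
residue₀ : ∀ a b → residue 0 (a ℤ.⊖ b) ≡ residue 2 (a ℤ.⊖ b) ℤ.+ (cos a ℤ.* cos b ℤ.+ sin a ℤ.* sin b)
residue₀ = agree-difference (residue-difference 0) (+-difference (residue-difference 2) cos-difference)
  (agree refl refl refl refl) (agree refl refl refl refl)

-- `(−1)ᵈ` counts classes 0 and 2 minus classes 1 and 3. The sine term, class 1 minus class 3,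
-- trades class 3 for a second copy of class 1.
residue₀₂ : ∀ a b →
  residue 0 (a ℤ.⊖ b) ℤ.+ residue 2 (a ℤ.⊖ b) ℤ.+ (sin a ℤ.* cos b ℤ.+ -1ℤ ℤ.* (cos a ℤ.* sin b)) ≡
  residue 1 (a ℤ.⊖ b) ℤ.+ residue 1 (a ℤ.⊖ b) ℤ.+ ε a ℤ.* ε b
residue₀₂ = agree-difference
  (+-difference (+-difference (residue-difference 0) (residue-difference 2)) sin-difference)
  (+-difference (+-difference (residue-difference 1) (residue-difference 1)) ε-difference)
  (agree refl refl refl refl) (agree refl refl refl refl)

-- Weighted sums over colored partitions

colored : ℕ → Series
colored k n = ∑ (λ _ → 1ℤ) (coloredPartitions k n)

∑-coloredPartitions : ∀ k w {F : Vec (List ℕ) (suc k) → ℤ} {G : Vec (List ℕ) k → ℤ} →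
  (∀ π πs → F (π ∷ πs) ≡ w (length π) ℤ.* G πs) →
  ∀ n → ∑ F (coloredPartitions (suc k) n) ≡ (lengthSeries w ⊛ (λ j → ∑ G (coloredPartitions k j))) n
∑-coloredPartitions k w {F} {G} F≡ n = ∑-convolution F
  (λ i j → cartesianProductWith _∷_ (partitions i) (coloredPartitions k j))
  (lengthSeries w) (λ j → ∑ G (coloredPartitions k j))
  (λ i j → ∑-cartesianProductWith _∷_ F≡ (partitions i) (coloredPartitions k j)) n

colored-zero : colored 0 ≗ 1̂
colored-zero zero    = refl
colored-zero (suc n) = refl

colored-suc : ∀ k → colored (suc k) ≗ P ⊛ colored k
colored-suc k = ∑-coloredPartitions k one (λ _ _ → refl)

onHead : ∀ {k} → (ℕ → ℤ) → Vec (List ℕ) (suc k) → ℤ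
onHead f (π ∷ _) = f (length π)

onPair : ∀ {k} → (ℕ → ℕ → ℤ) → Vec (List ℕ) (2 ℕ.+ k) → ℤ
onPair F (π₁ ∷ π₂ ∷ _) = F (length π₁) (length π₂)

onPair-cong : ∀ {k F G} → (∀ a b → F a b ≡ G a b) → onPair {k} F ≗ onPair G
onPair-cong F≡G (π₁ ∷ π₂ ∷ _) = F≡G _ _

∑-onPair-* : ∀ k u v n → ∑ (onPair λ a b → u a ℤ.* v b) (coloredPartitions (2 ℕ.+ k) n) ≡
  (lengthSeries u ⊛ lengthSeries v ⊛ colored k) n
∑-onPair-* k u v n = begin
  ∑ (onPair λ a b → u a ℤ.* v b) (coloredPartitions (2 ℕ.+ k) n)
    ≡⟨ ∑-coloredPartitions (suc k) u {G = onHead v} (λ where _ (_ ∷ _) → refl) n ⟩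
  (lengthSeries u ⊛ (λ j → ∑ (onHead v) (coloredPartitions (suc k) j))) n
    ≡⟨ ⊛-cong-≗ {lengthSeries u} (λ _ → refl)
         (∑-coloredPartitions k v {G = λ _ → 1ℤ} (λ π _ → sym (ℤ.*-identityʳ (v (length π))))) n ⟩
  (lengthSeries u ⊛ (lengthSeries v ⊛ colored k)) n
    ≡⟨ ⊛-assoc (lengthSeries u) (lengthSeries v) (colored k) n ⟨
  (lengthSeries u ⊛ lengthSeries v ⊛ colored k) n ∎
  where open ≡-Reasoning

∑-onPair-+ : ∀ {k} F G πss → ∑ (onPair {k} λ a b → F a b ℤ.+ G a b) πss ≡ ∑ (onPair F) πss ℤ.+ ∑ (onPair G) πss
∑-onPair-+ F G πss = trans (∑-cong (λ where (_ ∷ _ ∷ _) → refl) πss) (∑-+ (onPair F) (onPair G) πss)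

M≡∑ : ∀ k r n → + M (2 ℕ.+ k) r 4 n ≡ ∑ (onPair λ a b → residue r (a ℤ.⊖ b)) (coloredPartitions (2 ℕ.+ k) n)
M≡∑ k r n = trans (length-filter (λ πs → crank (2 ℕ.+ k) πs ≡? + r [mod 4 ]) (coloredPartitions (2 ℕ.+ k) n))
  (∑-cong (λ where (_ ∷ _ ∷ _) → refl) (coloredPartitions (2 ℕ.+ k) n))

M₀ : ∀ k n → + M (2 ℕ.+ k) 0 4 n ≡ + M (2 ℕ.+ k) 2 4 n ℤ.+ (X ⊛ colored k) n
M₀ k n = begin
  + M (2 ℕ.+ k) 0 4 n
    ≡⟨ M≡∑ k 0 n ⟩
  ∑ (onPair λ a b → residue 0 (a ℤ.⊖ b)) L
    ≡⟨ ∑-cong (onPair-cong residue₀) L ⟩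
  ∑ (onPair λ a b → residue 2 (a ℤ.⊖ b) ℤ.+ (cos a ℤ.* cos b ℤ.+ sin a ℤ.* sin b)) L
    ≡⟨ ∑-onPair-+ _ _ L ⟩
  ∑ (onPair λ a b → residue 2 (a ℤ.⊖ b)) L ℤ.+ ∑ (onPair λ a b → cos a ℤ.* cos b ℤ.+ sin a ℤ.* sin b) L
    ≡⟨ cong₂ ℤ._+_ (sym (M≡∑ k 2 n)) (∑-onPair-+ _ _ L) ⟩
  + M (2 ℕ.+ k) 2 4 n ℤ.+ (∑ (onPair λ a b → cos a ℤ.* cos b) L ℤ.+ ∑ (onPair λ a b → sin a ℤ.* sin b) L)
    ≡⟨ cong (ℤ._+_ (+ M (2 ℕ.+ k) 2 4 n)) (cong₂ ℤ._+_ (∑-onPair-* k cos cos n) (∑-onPair-* k sin sin n)) ⟩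
  + M (2 ℕ.+ k) 2 4 n ℤ.+ ((C ⊛ C ⊛ colored k) n ℤ.+ (S ⊛ S ⊛ colored k) n)
    ≡⟨ cong (ℤ._+_ (+ M (2 ℕ.+ k) 2 4 n)) (⊛-distribʳ (colored k) (C ⊛ C) (S ⊛ S) n) ⟨
  + M (2 ℕ.+ k) 2 4 n ℤ.+ (X ⊛ colored k) n ∎
  where
  open ≡-Reasoning
  L : List (Vec (List ℕ) (2 ℕ.+ k))
  L = coloredPartitions (2 ℕ.+ k) n

-- The sum is a coefficient of `(S C − C S) Pᵏ`: exchanging the first two colors changes the sign of
-- the crank.
∑-sin-difference : ∀ k n →
  ∑ (onPair λ a b → sin a ℤ.* cos b ℤ.+ -1ℤ ℤ.* (cos a ℤ.* sin b)) (coloredPartitions (2 ℕ.+ k) n) ≡ 0ℤ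
∑-sin-difference k n = begin
  ∑ (onPair λ a b → sin a ℤ.* cos b ℤ.+ -1ℤ ℤ.* (cos a ℤ.* sin b)) L
    ≡⟨ ∑-onPair-+ _ _ L ⟩
  ∑ (onPair λ a b → sin a ℤ.* cos b) L ℤ.+ ∑ (onPair λ a b → -1ℤ ℤ.* (cos a ℤ.* sin b)) L
    ≡⟨ cong₂ ℤ._+_ (∑-onPair-* k sin cos n)
         (trans (trans (∑-cong (λ where (_ ∷ _ ∷ _) → refl) L) (∑-*ˡ -1ℤ (onPair λ a b → cos a ℤ.* sin b) L))
           (cong (-1ℤ ℤ.*_) (trans (∑-onPair-* k cos sin n)
             (⊛-cong-≗ {C ⊛ S} {S ⊛ C} {colored k} (⊛-comm C S) (λ _ → refl) n)))) ⟩
  (S ⊛ C ⊛ colored k) n ℤ.+ -1ℤ ℤ.* (S ⊛ C ⊛ colored k) n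
    ≡⟨ cancel ((S ⊛ C ⊛ colored k) n) ⟩
  0ℤ ∎
  where
  open ≡-Reasoning
  L : List (Vec (List ℕ) (2 ℕ.+ k))
  L = coloredPartitions (2 ℕ.+ k) n
  cancel : ∀ x → x ℤ.+ -1ℤ ℤ.* x ≡ 0ℤ
  cancel = solve-∀

M₀+M₂ : ∀ k n → + M (2 ℕ.+ k) 0 4 n ℤ.+ + M (2 ℕ.+ k) 2 4 n ≡
  + M (2 ℕ.+ k) 1 4 n ℤ.+ + M (2 ℕ.+ k) 1 4 n ℤ.+ (E ⊛ E ⊛ colored k) n
M₀+M₂ k n = begin
  + M (2 ℕ.+ k) 0 4 n ℤ.+ + M (2 ℕ.+ k) 2 4 n
    ≡⟨ cong₂ ℤ._+_ (M≡∑ k 0 n) (M≡∑ k 2 n) ⟩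
  r 0 ℤ.+ r 2
    ≡⟨ ℤ.+-identityʳ _ ⟨
  -- The zero is replaced by the vanishing sine sum, so that `residue₀₂` applies term by term.
  r 0 ℤ.+ r 2 ℤ.+ 0ℤ
    ≡⟨ cong₂ ℤ._+_ (sym (∑-onPair-+ _ _ L)) (sym (∑-sin-difference k n)) ⟩
  ∑ (onPair λ a b → residue 0 (a ℤ.⊖ b) ℤ.+ residue 2 (a ℤ.⊖ b)) L ℤ.+
    ∑ (onPair λ a b → sin a ℤ.* cos b ℤ.+ -1ℤ ℤ.* (cos a ℤ.* sin b)) L
    ≡⟨ ∑-onPair-+ _ _ L ⟨
  ∑ (onPair λ a b → residue 0 (a ℤ.⊖ b) ℤ.+ residue 2 (a ℤ.⊖ b) ℤ.+
                    (sin a ℤ.* cos b ℤ.+ -1ℤ ℤ.* (cos a ℤ.* sin b))) L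
    ≡⟨ ∑-cong (onPair-cong residue₀₂) L ⟩
  ∑ (onPair λ a b → residue 1 (a ℤ.⊖ b) ℤ.+ residue 1 (a ℤ.⊖ b) ℤ.+ ε a ℤ.* ε b) L
    ≡⟨ ∑-onPair-+ _ _ L ⟩
  ∑ (onPair λ a b → residue 1 (a ℤ.⊖ b) ℤ.+ residue 1 (a ℤ.⊖ b)) L ℤ.+ ∑ (onPair λ a b → ε a ℤ.* ε b) L
    ≡⟨ cong₂ ℤ._+_ (trans (∑-onPair-+ _ _ L) (cong₂ ℤ._+_ (sym (M≡∑ k 1 n)) (sym (M≡∑ k 1 n))))
                   (∑-onPair-* k ε ε n) ⟩
  + M (2 ℕ.+ k) 1 4 n ℤ.+ + M (2 ℕ.+ k) 1 4 n ℤ.+ (E ⊛ E ⊛ colored k) n ∎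
  where
  open ≡-Reasoning
  L : List (Vec (List ℕ) (2 ℕ.+ k))
  L = coloredPartitions (2 ℕ.+ k) n
  r : ℕ → ℤ
  r j = ∑ (onPair λ a b → residue j (a ℤ.⊖ b)) L

-- Comparison of the residue classes

open import Data.Nat.Base using (_+_; _*_; _>_; _≥_; NonTrivial)

⊛-nonneg : ∀ {f g} → (∀ n → 0ℤ ℤ.≤ f n) → (∀ n → 0ℤ ℤ.< g n) → ∀ n → 0ℤ ℤ.≤ (f ⊛ g) n
⊛-nonneg {f} {g} 0≤f 0<g n = go f 0≤f n
  where
  term : ∀ {a} i → 0ℤ ℤ.≤ a → 0ℤ ℤ.≤ a ℤ.* g i
  term i 0≤a = ℤ.*-monoʳ-≤-nonNeg (g i) {{ℤ.nonNegative (ℤ.<⇒≤ (0<g i))}} 0≤a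
  go : ∀ f → (∀ n → 0ℤ ℤ.≤ f n) → ∀ n → 0ℤ ℤ.≤ (f ⊛ g) n
  go f 0≤f zero    = term 0 (0≤f 0)
  go f 0≤f (suc n) = ℤ.+-mono-≤ (term (suc n) (0≤f 0)) (go (f ∘ suc) (0≤f ∘ suc) n)

-- The summand `f 0 * g n` alone is positive, and the others do no harm.
⊛-positive : ∀ {f g} → (∀ n → 0ℤ ℤ.≤ f n) → 0ℤ ℤ.< f 0 → (∀ n → 0ℤ ℤ.< g n) → ∀ n → 0ℤ ℤ.< (f ⊛ g) n
⊛-positive {f} {g} 0≤f 0<f₀ 0<g = λ where
    zero    → term 0
    (suc n) → ℤ.+-mono-<-≤ (term (suc n)) (⊛-nonneg {f ∘ suc} {g} (0≤f ∘ suc) 0<g n)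
  where
  term : ∀ i → 0ℤ ℤ.< f 0 ℤ.* g i
  term i = ℤ.*-monoʳ-<-pos (g i) {{ℤ.positive (0<g i)}} 0<f₀

colored-positive : ∀ k n → 0ℤ ℤ.< colored (suc k) n
colored-positive k n = subst (0ℤ ℤ.<_) (sym (trans (colored-suc k n) (⊛-comm P (colored k) n)))
  (⊛-positive {colored k} {P} (nonneg k) (positive₀ k) P-positive n)
  where
  nonneg : ∀ k n → 0ℤ ℤ.≤ colored k n
  nonneg zero    zero    = ℤ.+≤+ z≤n
  nonneg zero    (suc n) = ℤ.≤-refl
  nonneg (suc k) n       = ℤ.<⇒≤ (colored-positive k n)
  positive₀ : ∀ k → 0ℤ ℤ.< colored k 0
  positive₀ zero    = 0<1
  positive₀ (suc k) = colored-positive k 0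

ε-±1 : ∀ n → ε n ≡ 1ℤ ⊎ ε n ≡ -1ℤ
ε-±1 zero    = inj₁ refl
ε-±1 (suc n) with ε-±1 n
... | inj₁ ε≡1  = inj₂ (cong ℤ.-_ ε≡1)
... | inj₂ ε≡-1 = inj₁ (cong ℤ.-_ ε≡-1)

-- The two series are twice the even part and twice the odd part of `G`.
G±εG-nonneg : ∀ {G : Series} → (∀ n → 0ℤ ℤ.< G n) → ∀ n →
  0ℤ ℤ.≤ G n ℤ.+ ε n ℤ.* G n × 0ℤ ℤ.≤ G n ℤ.+ -1ℤ ℤ.* (ε n ℤ.* G n)
G±εG-nonneg {G} 0<G n = [ (λ ε≡1 → subst Claim (sym ε≡1) (subst (0ℤ ℤ.≤_) (add₁ g) 0≤g+g , ℤ.≤-reflexive (cancel₁ g)))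
                        , (λ ε≡-1 → subst Claim (sym ε≡-1) (ℤ.≤-reflexive (cancel₂ g) , subst (0ℤ ℤ.≤_) (add₂ g) 0≤g+g)) ]′ (ε-±1 n)
  where
  g : ℤ
  g = G n
  Claim : ℤ → Set
  Claim e = 0ℤ ℤ.≤ g ℤ.+ e ℤ.* g × 0ℤ ℤ.≤ g ℤ.+ -1ℤ ℤ.* (e ℤ.* g)
  0≤g+g : 0ℤ ℤ.≤ g ℤ.+ g
  0≤g+g = ℤ.+-mono-≤ (ℤ.<⇒≤ (0<G n)) (ℤ.<⇒≤ (0<G n))
  add₁ : ∀ g → g ℤ.+ g ≡ g ℤ.+ 1ℤ ℤ.* g
  add₁ = solve-∀
  add₂ : ∀ g → g ℤ.+ g ≡ g ℤ.+ -1ℤ ℤ.* (-1ℤ ℤ.* g)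
  add₂ = solve-∀
  cancel₁ : ∀ g → 0ℤ ≡ g ℤ.+ -1ℤ ℤ.* (1ℤ ℤ.* g)
  cancel₁ = solve-∀
  cancel₂ : ∀ g → 0ℤ ≡ g ℤ.+ -1ℤ ℤ.* g
  cancel₂ = solve-∀

-- The relation for class 1 involves twice its count, so all comparisons are made between doubled
-- counts.
double-< : ∀ a b d → + a ℤ.+ + a ≡ + b ℤ.+ + b ℤ.+ d → 0ℤ ℤ.< d → a > b
double-< a b d e 0<d = ℕ.≰⇒> λ a≤b → ℤ.<-irrefl refl (begin-strict
  + b ℤ.+ + b        ≡⟨ ℤ.+-identityʳ _ ⟨
  + b ℤ.+ + b ℤ.+ 0ℤ <⟨ ℤ.+-monoʳ-< (+ b ℤ.+ + b) 0<d ⟩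
  + b ℤ.+ + b ℤ.+ d  ≡⟨ e ⟨
  + a ℤ.+ + a        ≤⟨ ℤ.+-mono-≤ (ℤ.+≤+ a≤b) (ℤ.+≤+ a≤b) ⟩
  + b ℤ.+ + b        ∎)
  where open ℤ.≤-Reasoning

double-> : ∀ a b d → + a ℤ.+ + a ≡ + b ℤ.+ + b ℤ.+ d → d ℤ.< 0ℤ → b > a
double-> a b d e d<0 = double-< b a (ℤ.- d)
  (trans (add-cancel (+ b ℤ.+ + b) d) (cong (ℤ._- d) (sym e))) (ℤ.neg-mono-< d<0)
  where
  add-cancel : ∀ a y → a ≡ a ℤ.+ y ℤ.- y
  add-cancel = solve-∀

double-≡ : ∀ a b d → + a ℤ.+ + a ≡ + b ℤ.+ + b ℤ.+ d → d ≡ 0ℤ → a ≡ b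
double-≡ a b d e refl = ℤ.+-injective (ℤ.*-cancelˡ-≡ (+ 2) (+ a) (+ b)
  (trans (twice (+ a)) (trans e (trans (ℤ.+-identityʳ _) (sym (twice (+ b)))))))
  where
  twice : ∀ i → + 2 ℤ.* i ≡ i ℤ.+ i
  twice = solve-∀

-- The order of the three classes is decided by the signs of `x`, `x + y` and `x − y`, which are
-- half of `2m₀ − 2m₂`, then `2m₀ − 2m₁`, and `2m₁ − 2m₂`.
module Compare (m₀ m₁ m₂ : ℕ) (x y : ℤ) (e₀ : + m₀ ≡ + m₂ ℤ.+ x)
  (e₁ : + m₀ ℤ.+ + m₂ ≡ + m₁ ℤ.+ + m₁ ℤ.+ y) where

  private
    2m₀≡2m₂ : + m₀ ℤ.+ + m₀ ≡ + m₂ ℤ.+ + m₂ ℤ.+ (x ℤ.+ x)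
    2m₀≡2m₂ = trans (cong₂ ℤ._+_ e₀ e₀) (rearrange (+ m₂) x)
      where
      rearrange : ∀ a x → a ℤ.+ x ℤ.+ (a ℤ.+ x) ≡ a ℤ.+ a ℤ.+ (x ℤ.+ x)
      rearrange = solve-∀

    2m₀≡2m₁ : + m₀ ℤ.+ + m₀ ≡ + m₁ ℤ.+ + m₁ ℤ.+ (x ℤ.+ y)
    2m₀≡2m₁ = trans (cong (ℤ._+_ (+ m₀)) e₀) (trans (rearrange (+ m₀) (+ m₂) x)
      (trans (cong (ℤ._+ x) e₁) (rearrange′ (+ m₁ ℤ.+ + m₁) x y)))
      where
      rearrange : ∀ a b x → a ℤ.+ (b ℤ.+ x) ≡ a ℤ.+ b ℤ.+ x
      rearrange = solve-∀
      rearrange′ : ∀ a x y → a ℤ.+ y ℤ.+ x ≡ a ℤ.+ (x ℤ.+ y)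
      rearrange′ = solve-∀

    2m₁≡2m₂ : + m₁ ℤ.+ + m₁ ≡ + m₂ ℤ.+ + m₂ ℤ.+ (x ℤ.- y)
    2m₁≡2m₂ = trans (add-cancel (+ m₁ ℤ.+ + m₁) y) (trans (cong (ℤ._- y) (sym e₁))
      (trans (cong (λ t → t ℤ.+ + m₂ ℤ.- y) e₀) (rearrange (+ m₂) x y)))
      where
      add-cancel : ∀ a y → a ≡ a ℤ.+ y ℤ.- y
      add-cancel = solve-∀
      rearrange : ∀ a x y → a ℤ.+ x ℤ.+ a ℤ.- y ≡ a ℤ.+ a ℤ.+ (x ℤ.- y)
      rearrange = solve-∀

  m₀>m₂ : 0ℤ ℤ.< x → m₀ > m₂
  m₀>m₂ 0<x = double-< m₀ m₂ _ 2m₀≡2m₂ (ℤ.+-mono-< 0<x 0<x)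

  m₂>m₀ : x ℤ.< 0ℤ → m₂ > m₀
  m₂>m₀ x<0 = double-> m₀ m₂ _ 2m₀≡2m₂ (ℤ.+-mono-< x<0 x<0)

  m₀≡m₂ : x ≡ 0ℤ → m₀ ≡ m₂
  m₀≡m₂ x≡0 = double-≡ m₀ m₂ _ 2m₀≡2m₂ (cong₂ ℤ._+_ x≡0 x≡0)

  m₀>m₁ : 0ℤ ℤ.< x ℤ.+ y → m₀ > m₁
  m₀>m₁ = double-< m₀ m₁ _ 2m₀≡2m₁

  m₁>m₀ : x ℤ.+ y ℤ.< 0ℤ → m₁ > m₀
  m₁>m₀ = double-> m₀ m₁ _ 2m₀≡2m₁

  m₀≡m₁ : x ℤ.+ y ≡ 0ℤ → m₀ ≡ m₁
  m₀≡m₁ = double-≡ m₀ m₁ _ 2m₀≡2m₁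

  m₁>m₂ : 0ℤ ℤ.< x ℤ.- y → m₁ > m₂
  m₁>m₂ = double-< m₁ m₂ _ 2m₁≡2m₂

  m₂>m₁ : x ℤ.- y ℤ.< 0ℤ → m₂ > m₁
  m₂>m₁ = double-> m₁ m₂ _ 2m₁≡2m₂

  m₁≡m₂ : x ℤ.- y ≡ 0ℤ → m₁ ≡ m₂
  m₁≡m₂ = double-≡ m₁ m₂ _ 2m₁≡2m₂

module CompareM (k n : ℕ) {x y : ℤ} (x≡ : (X ⊛ colored k) n ≡ x) (y≡ : (E ⊛ E ⊛ colored k) n ≡ y) =
  Compare (M (2 + k) 0 4 n) (M (2 + k) 1 4 n) (M (2 + k) 2 4 n) x y
    (trans (M₀ k n) (cong (ℤ._+_ (+ M (2 + k) 2 4 n)) x≡))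
    (trans (M₀+M₂ k n) (cong (ℤ._+_ (+ M (2 + k) 1 4 n ℤ.+ + M (2 + k) 1 4 n)) y≡))

⊛-identityʳ : ∀ f → f ⊛ 1̂ ≗ f
⊛-identityʳ f n = trans (⊛-comm f 1̂ n) (⊛-identityˡ f n)

⊛-colored₀ : ∀ f → f ⊛ colored 0 ≗ f
⊛-colored₀ f n = trans (⊛-cong-≗ {f} (λ _ → refl) colored-zero n) (⊛-identityʳ f n)

⊛-colored-suc : ∀ f k → f ⊛ colored (suc k) ≗ f ⊛ P ⊛ colored k
⊛-colored-suc f k n = trans (⊛-cong-≗ {f} (λ _ → refl) (colored-suc k) n)
  (sym (⊛-assoc f P (colored k) n))

-- Two colors

module Two n = CompareM 0 n (⊛-colored₀ X n) (⊛-colored₀ (E ⊛ E) n)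

-- With `x = X n` and `y = (E ⊛ E) n`, the bounds `0 < x < y` give both inequalities.
two-4n : ∀ j → let n = suc (suc j) + suc (suc j) + (suc (suc j) + suc (suc j)) in
  M 2 0 4 n > M 2 2 4 n × M 2 2 4 n > M 2 1 4 n
two-4n j = Two.m₀>m₂ n (proj₁ (X-4n j)) , Two.m₂>m₁ n
  (subst (X n ℤ.- Y ℤ.<_) (ℤ.+-inverseʳ Y) (ℤ.+-monoˡ-< (ℤ.- Y) (proj₂ (X-4n j))))
  where
  n : ℕ
  n = suc (suc j) + suc (suc j) + (suc (suc j) + suc (suc j))
  Y : ℤ
  Y = (E ⊛ E) n

two-4n+2 : ∀ j → let n = odd (suc j) + odd (suc j) in
  M 2 2 4 n > M 2 0 4 n × M 2 0 4 n > M 2 1 4 n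
two-4n+2 j = Two.m₂>m₀ n (proj₁ (X-4n+2 j)) , Two.m₀>m₁ n
  (subst (ℤ._< X n ℤ.+ (E ⊛ E) n) (ℤ.+-inverseʳ (X n)) (ℤ.+-monoʳ-< (X n) (proj₂ (X-4n+2 j))))
  where
  n : ℕ
  n = odd (suc j) + odd (suc j)

two-odd : ∀ i → M 2 1 4 (odd i) > M 2 0 4 (odd i) × M 2 0 4 (odd i) ≡ M 2 2 4 (odd i)
two-odd i = Two.m₁>m₀ (odd i)
    (subst (ℤ._< 0ℤ) (sym (trans (cong (ℤ._+ (E ⊛ E) (odd i)) (X-odd i)) (ℤ.+-identityˡ _))) (E²-odd i))
  , Two.m₀≡m₂ (odd i) (X-odd i)

-- Three colors

G : Series
G = X ⊛ P

module Three n = CompareM 1 n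
  (trans (⊛-colored-suc X 0 n) (⊛-colored₀ G n))
  (trans (⊛-colored-suc (E ⊛ E) 0 n) (trans (⊛-colored₀ (E ⊛ E ⊛ P) n) (E²P≗ε⊙XP n)))

-- At even indices `y = x > 0`, so `x − y` vanishes; at odd indices, treated next, `y = −x` and
-- `x + y` vanishes.
three-even : ∀ m → let n = m + m in M 3 0 4 n > M 3 1 4 n × M 3 1 4 n ≡ M 3 2 4 n
three-even m = Three.m₀>m₁ n 0<x+y , Three.m₁≡m₂ n x-y≡0
  where
  n : ℕ
  n = m + m
  y≡x : ε n ℤ.* G n ≡ G n
  y≡x = trans (cong (ℤ._* G n) (ε-double m)) (ℤ.*-identityˡ (G n))
  0<x+y : 0ℤ ℤ.< G n ℤ.+ ε n ℤ.* G n
  0<x+y = subst (λ t → 0ℤ ℤ.< G n ℤ.+ t) (sym y≡x) (ℤ.+-mono-< (XP-positive n) (XP-positive n))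
  x-y≡0 : G n ℤ.- ε n ℤ.* G n ≡ 0ℤ
  x-y≡0 = trans (cong (λ t → G n ℤ.- t) y≡x) (ℤ.+-inverseʳ (G n))

three-odd : ∀ i → let n = odd i in M 3 0 4 n ≡ M 3 1 4 n × M 3 1 4 n > M 3 2 4 n
three-odd i = Three.m₀≡m₁ n x+y≡0 , Three.m₁>m₂ n 0<x-y
  where
  n : ℕ
  n = odd i
  y≡-x : ε n ℤ.* G n ≡ ℤ.- G n
  y≡-x = trans (cong (ℤ._* G n) (ε-odd i)) (ℤ.-1*i≡-i (G n))
  x+y≡0 : G n ℤ.+ ε n ℤ.* G n ≡ 0ℤ
  x+y≡0 = trans (cong (ℤ._+_ (G n)) y≡-x) (ℤ.+-inverseʳ (G n))
  0<x-y : 0ℤ ℤ.< G n ℤ.- ε n ℤ.* G n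
  0<x-y = subst (0ℤ ℤ.<_) (sym (trans (cong (λ t → G n ℤ.- t) y≡-x) (cong (ℤ._+_ (G n)) (ℤ.neg-involutive (G n)))))
    (ℤ.+-mono-< (XP-positive n) (XP-positive n))

-- Four or more colors

module _ (k : ℕ) where
  private
    R : Series
    R = colored (suc k)

  module FourOrMore n = CompareM (2 + k) n
    (⊛-colored-suc X (suc k) n)
    (trans (⊛-colored-suc (E ⊛ E) (suc k) n) (⊛-cong-≗ {E ⊛ E ⊛ P} {ε ⊙ G} {R} E²P≗ε⊙XP (λ _ → refl) n))

  -- Twice the even part of `G` has a positive constant term, and multiplying by `R` spreads
  -- positivity to every index.
  four-m₀>m₁ : ∀ n → M (4 + k) 0 4 n > M (4 + k) 1 4 n
  four-m₀>m₁ n = FourOrMore.m₀>m₁ n (subst (0ℤ ℤ.<_) (⊛-distribʳ R G (ε ⊙ G) n)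
    (⊛-positive {G ⊕ ε ⊙ G} {R} (proj₁ ∘ G±εG-nonneg {G} XP-positive) (ℤ.+<+ (s≤s z≤n)) (colored-positive k) n))

  -- `H` is twice the odd part of `G` and first becomes positive at index 1, hence the index `suc n`
  -- and the use of `H ∘ suc` in place of `H`.
  four-m₁>m₂ : ∀ n → M (4 + k) 1 4 (suc n) > M (4 + k) 2 4 (suc n)
  four-m₁>m₂ n = FourOrMore.m₁>m₂ (suc n) (subst (0ℤ ℤ.<_) split
    (⊛-positive {H ∘ suc} {R} H∘suc-nonneg H₁-positive (colored-positive k) n))
    where
    open ≡-Reasoning
    -εG H : Series
    -εG i = -1ℤ ℤ.* (ε ⊙ G) i
    H = G ⊕ -εG
    split : (H ∘ suc ⊛ R) n ≡ (G ⊛ R) (suc n) ℤ.- (ε ⊙ G ⊛ R) (suc n)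
    split = begin
      (H ∘ suc ⊛ R) n                                  ≡⟨ ℤ.+-identityˡ _ ⟨
      -- Since `H 0` computes to 0, the added zero is the first summand of `(H ⊛ R) (suc n)`.
      0ℤ ℤ.+ (H ∘ suc ⊛ R) n                           ≡⟨ cong (ℤ._+ (H ∘ suc ⊛ R) n) (ℤ.*-zeroˡ (R (suc n))) ⟨
      (H ⊛ R) (suc n)                                  ≡⟨ ⊛-distribʳ R G -εG (suc n) ⟩
      (G ⊛ R) (suc n) ℤ.+ (-εG ⊛ R) (suc n)            ≡⟨ cong (ℤ._+_ ((G ⊛ R) (suc n)))
                                                            (trans (⊛-scaleˡ -1ℤ (ε ⊙ G) R (suc n)) (ℤ.-1*i≡-i _)) ⟩
      (G ⊛ R) (suc n) ℤ.- (ε ⊙ G ⊛ R) (suc n)          ∎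
    H∘suc-nonneg : ∀ n → 0ℤ ℤ.≤ H (suc n)
    H∘suc-nonneg n = proj₂ (G±εG-nonneg {G} XP-positive (suc n))
    H₁-positive : 0ℤ ℤ.< H 1
    H₁-positive = ℤ.+<+ (s≤s z≤n)

theorem2p5 : (n : ℕ) → n > 0 →
    (n ≢ 1 → M 2 0 4 (4 * n) > M 2 2 4 (4 * n) × M 2 2 4 (4 * n) > M 2 1 4 (4 * n))
    × (M 2 2 4 (4 * n + 2) > M 2 0 4 (4 * n + 2) × M 2 0 4 (4 * n + 2) > M 2 1 4 (4 * n + 2))
    × (M 2 1 4 (2 * n + 1) > M 2 0 4 (2 * n + 1) × M 2 0 4 (2 * n + 1) ≡ M 2 2 4 (2 * n + 1))
    × (M 3 0 4 (2 * n) > M 3 1 4 (2 * n) × M 3 1 4 (2 * n) ≡ M 3 2 4 (2 * n))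
    × (M 3 0 4 (2 * n + 1) ≡ M 3 1 4 (2 * n + 1) × M 3 1 4 (2 * n + 1) > M 3 2 4 (2 * n + 1))
    × ((k : ℕ) .{{_ : NonTrivial k}} → k ≥ 4 → M k 0 4 n > M k 1 4 n × M k 1 4 n > M k 2 4 n)
theorem2p5 (suc j) _ =
    at-4n j
  , subst (λ N → M 2 2 4 N > M 2 0 4 N × M 2 0 4 N > M 2 1 4 N) (4n+2 j) (two-4n+2 j)
  , subst (λ N → M 2 1 4 N > M 2 0 4 N × M 2 0 4 N ≡ M 2 2 4 N) (2n+1 j) (two-odd (suc j))
  , subst (λ N → M 3 0 4 N > M 3 1 4 N × M 3 1 4 N ≡ M 3 2 4 N) (2n j) (three-even (suc j))
  , subst (λ N → M 3 0 4 N ≡ M 3 1 4 N × M 3 1 4 N > M 3 2 4 N) (2n+1 j) (three-odd (suc j))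
  , λ { (suc (suc (suc (suc k)))) _ → four-m₀>m₁ k (suc j) , four-m₁>m₂ k j
      ; (suc (suc (suc zero))) (s≤s (s≤s (s≤s ())))
      ; (suc (suc zero)) (s≤s (s≤s ()))
      ; (suc zero) (s≤s ())
      }
  where
  4n : ∀ j → suc (suc j) + suc (suc j) + (suc (suc j) + suc (suc j)) ≡ 4 * suc (suc j)
  4n = ℕSolver.solve-∀
  4n+2 : ∀ j → suc (suc j + suc j) + suc (suc j + suc j) ≡ 4 * suc j + 2
  4n+2 = ℕSolver.solve-∀
  2n : ∀ j → suc j + suc j ≡ 2 * suc j
  2n = ℕSolver.solve-∀
  2n+1 : ∀ j → suc (suc j + suc j) ≡ 2 * suc j + 1
  2n+1 = ℕSolver.solve-∀
  at-4n : ∀ j → suc j ≢ 1 → M 2 0 4 (4 * suc j) > M 2 2 4 (4 * suc j) × M 2 2 4 (4 * suc j) > M 2 1 4 (4 * suc j)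
  at-4n zero    1≢1 = contradiction refl 1≢1
  at-4n (suc j) _   = subst (λ N → M 2 0 4 N > M 2 2 4 N × M 2 2 4 N > M 2 1 4 N) (4n j) (two-4n j)
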